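{- For every integer $k$ with $4\leq k\leq 19$ and every prime power $q$ the following holds: for $j\in\{3,4,5,6\}$, $\gamma(k,q)$ exists and equals $j$ if and only if $q$ appears in the list below for $k$ under "$\gamma=j$" (if no list is given for some $j$, it is empty). $k=4$. $\gamma=3$: 13, 17, 25, 29. $\gamma=4$: 5. $k=5$. $\gamma=3$: 31, 41, 61. $\gamma=5$: 11. $k=6$. $\gamma=3$: 37, 43, 49, 61, 67, 73, 79, 109, 139, 223. $\gamma=4$: 19, 31. $\gamma=6$: 7, 13. $k=7$. $\gamma=3$: 64, 71, 113, 127. $\gamma=4$: 29, 43. $k=8$. $\gamma=3$: 13, 29, 73, 81, 89, 97, 113, 121, 137, 233, 257, 289, 337, 761. $\gamma=4$: 5, 25, 41. $k=9$. $\gamma=3$: 7, 73, 109, 127, 163, 181, 199, 271, 307, 343. $\gamma=5$: 37. $k=10$. $\gamma=3$: 71, 101, 121, 131, 151, 181, 191, 211, 241, 251, 271, 281, 311, 331, 401, 421, 431, 461, 491, 641, 911. $\gamma=4$: 41, 61. $\gamma=5$: 31. $k=11$. $\gamma=3$: 199, 331, 353, 419, 463, 617. $\gamma=4$: 89. $\gamma=5$: 67. $k=12$. $\gamma=3$: 17, 29, 43, 67, 79, 139, 157, 169, 181, 193, 223, 241, 277, 289, 313, 337, 349, 361, 373, 397, 409, 421, 433, 457, 541, 577, 625, 661, 673, 733, 841, 877, 1069, 1453, 1669, 1741. $\gamma=4$: 5, 19, 31, 61, 97, 109, 229. $\gamma=5$: 73. $\gamma=6$: 7, 37, 49. $k=13$.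 $\gamma=3$: 131, 157, 313, 443, 521, 547, 599, 677, 859, 911, 937, 1171. $\gamma=5$: 79. $\gamma=6$: 53. $k=14$. $\gamma=3$: 64, 197, 211, 239, 281, 337, 379, 421, 449, 463, 491, 547, 617, 631, 659, 673, 701, 743, 757, 827, 911, 953, 967, 1009, 1499, 2927. $\gamma=4$: 71, 113, 127. $\gamma=6$: 43. $k=15$. $\gamma=3$: 7, 41, 151, 181, 211, 241, 256, 271, 331, 361, 421, 541, 571, 601, 631, 661, 691, 751, 811, 961, 991, 1021, 1051, 1171, 1201, 3181. $\gamma=4$: 121. $\gamma=5$: 11, 61. $k=16$. $\gamma=3$: 13, 29, 73, 89, 121, 137, 233, 241, 289, 337, 353, 401, 433, 449, 529, 577, 593, 625, 641, 673, 761, 769, 881, 929, 977, 1009, 1201, 1249, 1297, 1409, 1489, 1697, 2017, 2401, 2593. $\gamma=4$: 5, 25, 41, 81, 113, 193, 257. $\gamma=6$: 97. $k=17$. $\gamma=3$: 239, 307, 409, 443, 613, 647, 919, 953, 1021, 1123, 1259, 1327, 1361, 1531, 1667. $\gamma=4$: 137. $\gamma=6$: 103. $k=18$. $\gamma=3$: 43, 49, 61, 67, 79, 139, 223, 307, 343, 361, 379, 433, 487, 523, 541, 577, 613, 631, 739, 757, 811, 829, 883, 919, 937, 991, 1009, 1063, 1117, 1153, 1171, 1279, 1369, 1423, 1459, 1693, 1747, 2089, 2197, 2251, 2269, 2287, 2503, 2719, 3259, 4519. $\gamma=4$: 31, 163, 181, 271, 397. $\gamma=5$: 199. $\gamma=6$: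 7, 13, 109, 127. $k=19$. $\gamma=3$: 343, 457, 571, 647, 761, 1103, 1217, 1483, 1559, 1597, 1787, 2053, 2129, 2357, 2927. $\gamma=4$: 191, 229, 419.
   Context: For a positive integer $k$ and a prime power $q$, $\gamma(k,q)$ denotes the smallest positive integer $m$ such that every element of the finite field $\mathbb{F}_q$ with $q$ elements can be written as a sum of $m$ many $k$-th powers of elements of $\mathbb{F}_q$ ($0$ being a $k$-th power); it does not exist if some element of $\mathbb{F}_q$ is not a sum of $k$-th powers. -}

module Defs where

open import Level using (_⊔_)
open import Algebra.Apartness.Bundles using (HeytingField; HeytingCommutativeRing)
open import Algebra.Bundles using (CommutativeRing; Semiring)
import Algebra.Definitions.RawSemiring as RawSemiringDefinitions
open import Data.Fin.Base using (Fin)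
open import Data.List.Base using (List; []; _∷_)
open import Data.Nat.Base using (ℕ; _^_; _≤_)
open import Data.Nat.Primality using (Prime)
open import Data.Product.Base using (∃; ∃₂; _×_)
open import Data.Vec.Functional using (Vector)
open import Function.Bundles using (Inverse)
open import Relation.Binary.PropositionalEquality using (_≡_) renaming (setoid to ≡-setoid)

IsPrimePower : ℕ → Set
IsPrimePower q = ∃₂ λ p n → Prime p × 1 ≤ n × q ≡ p ^ n

-- On a finite carrier `_≈_` is decidable, so the apartness of a Heyting field
-- is equivalent to `_≉_`: finite Heyting fields are exactly finite fields.

module _ {c ℓ₁ ℓ₂} (F : HeytingField c ℓ₁ ℓ₂) where

  private
    commutativeRing : CommutativeRing c ℓ₁
    commutativeRing =
      HeytingCommutativeRing.commutativeRing (HeytingField.heytingCommutativeRing F)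

  open CommutativeRing commutativeRing using (Carrier; _≈_; setoid; semiring)
  open RawSemiringDefinitions (Semiring.rawSemiring semiring)
    using (sum) renaming (_^_ to _^ᶠ_)

  -- The carrier is counted up to `_≈_`.
  HasOrder : ℕ → Set (c ⊔ ℓ₁)
  HasOrder q = Inverse setoid (≡-setoid (Fin q))

  IsSumOfPowers : (k m : ℕ) → Carrier → Set (c ⊔ ℓ₁)
  IsSumOfPowers k m a = ∃ λ (x : Vector Carrier m) → sum (λ i → x i ^ᶠ k) ≈ a

  -- `IsWaringNumber k m` says that γ(k, F) exists and equals m. It is a relation
  -- rather than a function because γ is only partially defined.
  record IsWaringNumber (k m : ℕ) : Set (c ⊔ ℓ₁) where
    field
      positive : 1 ≤ m
      covers   : ∀ a → IsSumOfPowers k m a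
      minimal  : ∀ n → 1 ≤ n → (∀ a → IsSumOfPowers k n a) → m ≤ n

-- The prime powers q tabulated as having γ(k, q) = j, for 4 ≤ k ≤ 19 and
-- 3 ≤ j ≤ 6; nothing is claimed outside these ranges, e.g. γ(10, 11) = 10.
waringList : (k j : ℕ) → List ℕ
waringList 4 3 = 13 ∷ 17 ∷ 25 ∷ 29 ∷ []
waringList 4 4 = 5 ∷ []
waringList 5 3 = 31 ∷ 41 ∷ 61 ∷ []
waringList 5 5 = 11 ∷ []
waringList 6 3 = 37 ∷ 43 ∷ 49 ∷ 61 ∷ 67 ∷ 73 ∷ 79 ∷ 109 ∷ 139 ∷ 223 ∷ []
waringList 6 4 = 19 ∷ 31 ∷ []
waringList 6 6 = 7 ∷ 13 ∷ []
waringList 7 3 = 64 ∷ 71 ∷ 113 ∷ 127 ∷ []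
waringList 7 4 = 29 ∷ 43 ∷ []
waringList 8 3 =
  13 ∷ 29 ∷ 73 ∷ 81 ∷ 89 ∷ 97 ∷ 113 ∷ 121 ∷ 137 ∷ 233 ∷ 257 ∷ 289 ∷ 337 ∷
  761 ∷ []
waringList 8 4 = 5 ∷ 25 ∷ 41 ∷ []
waringList 9 3 = 7 ∷ 73 ∷ 109 ∷ 127 ∷ 163 ∷ 181 ∷ 199 ∷ 271 ∷ 307 ∷ 343 ∷ []
waringList 9 5 = 37 ∷ []
waringList 10 3 =
  71 ∷ 101 ∷ 121 ∷ 131 ∷ 151 ∷ 181 ∷ 191 ∷ 211 ∷ 241 ∷ 251 ∷ 271 ∷ 281 ∷
  311 ∷ 331 ∷ 401 ∷ 421 ∷ 431 ∷ 461 ∷ 491 ∷ 641 ∷ 911 ∷ []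
waringList 10 4 = 41 ∷ 61 ∷ []
waringList 10 5 = 31 ∷ []
waringList 11 3 = 199 ∷ 331 ∷ 353 ∷ 419 ∷ 463 ∷ 617 ∷ []
waringList 11 4 = 89 ∷ []
waringList 11 5 = 67 ∷ []
waringList 12 3 =
  17 ∷ 29 ∷ 43 ∷ 67 ∷ 79 ∷ 139 ∷ 157 ∷ 169 ∷ 181 ∷ 193 ∷ 223 ∷ 241 ∷ 277 ∷
  289 ∷ 313 ∷ 337 ∷ 349 ∷ 361 ∷ 373 ∷ 397 ∷ 409 ∷ 421 ∷ 433 ∷ 457 ∷ 541 ∷
  577 ∷ 625 ∷ 661 ∷ 673 ∷ 733 ∷ 841 ∷ 877 ∷ 1069 ∷ 1453 ∷ 1669 ∷ 1741 ∷ []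
waringList 12 4 = 5 ∷ 19 ∷ 31 ∷ 61 ∷ 97 ∷ 109 ∷ 229 ∷ []
waringList 12 5 = 73 ∷ []
waringList 12 6 = 7 ∷ 37 ∷ 49 ∷ []
waringList 13 3 =
  131 ∷ 157 ∷ 313 ∷ 443 ∷ 521 ∷ 547 ∷ 599 ∷ 677 ∷ 859 ∷ 911 ∷ 937 ∷ 1171 ∷
  []
waringList 13 5 = 79 ∷ []
waringList 13 6 = 53 ∷ []
waringList 14 3 =
  64 ∷ 197 ∷ 211 ∷ 239 ∷ 281 ∷ 337 ∷ 379 ∷ 421 ∷ 449 ∷ 463 ∷ 491 ∷ 547 ∷
  617 ∷ 631 ∷ 659 ∷ 673 ∷ 701 ∷ 743 ∷ 757 ∷ 827 ∷ 911 ∷ 953 ∷ 967 ∷ 1009 ∷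
  1499 ∷ 2927 ∷ []
waringList 14 4 = 71 ∷ 113 ∷ 127 ∷ []
waringList 14 6 = 43 ∷ []
waringList 15 3 =
  7 ∷ 41 ∷ 151 ∷ 181 ∷ 211 ∷ 241 ∷ 256 ∷ 271 ∷ 331 ∷ 361 ∷ 421 ∷ 541 ∷
  571 ∷ 601 ∷ 631 ∷ 661 ∷ 691 ∷ 751 ∷ 811 ∷ 961 ∷ 991 ∷ 1021 ∷ 1051 ∷
  1171 ∷ 1201 ∷ 3181 ∷ []
waringList 15 4 = 121 ∷ []
waringList 15 5 = 11 ∷ 61 ∷ []
waringList 16 3 =
  13 ∷ 29 ∷ 73 ∷ 89 ∷ 121 ∷ 137 ∷ 233 ∷ 241 ∷ 289 ∷ 337 ∷ 353 ∷ 401 ∷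
  433 ∷ 449 ∷ 529 ∷ 577 ∷ 593 ∷ 625 ∷ 641 ∷ 673 ∷ 761 ∷ 769 ∷ 881 ∷ 929 ∷
  977 ∷ 1009 ∷ 1201 ∷ 1249 ∷ 1297 ∷ 1409 ∷ 1489 ∷ 1697 ∷ 2017 ∷ 2401 ∷
  2593 ∷ []
waringList 16 4 = 5 ∷ 25 ∷ 41 ∷ 81 ∷ 113 ∷ 193 ∷ 257 ∷ []
waringList 16 6 = 97 ∷ []
waringList 17 3 =
  239 ∷ 307 ∷ 409 ∷ 443 ∷ 613 ∷ 647 ∷ 919 ∷ 953 ∷ 1021 ∷ 1123 ∷ 1259 ∷
  1327 ∷ 1361 ∷ 1531 ∷ 1667 ∷ []
waringList 17 4 = 137 ∷ []
waringList 17 6 = 103 ∷ []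
waringList 18 3 =
  43 ∷ 49 ∷ 61 ∷ 67 ∷ 79 ∷ 139 ∷ 223 ∷ 307 ∷ 343 ∷ 361 ∷ 379 ∷ 433 ∷ 487 ∷
  523 ∷ 541 ∷ 577 ∷ 613 ∷ 631 ∷ 739 ∷ 757 ∷ 811 ∷ 829 ∷ 883 ∷ 919 ∷ 937 ∷
  991 ∷ 1009 ∷ 1063 ∷ 1117 ∷ 1153 ∷ 1171 ∷ 1279 ∷ 1369 ∷ 1423 ∷ 1459 ∷
  1693 ∷ 1747 ∷ 2089 ∷ 2197 ∷ 2251 ∷ 2269 ∷ 2287 ∷ 2503 ∷ 2719 ∷ 3259 ∷
  4519 ∷ []
waringList 18 4 = 31 ∷ 163 ∷ 181 ∷ 271 ∷ 397 ∷ []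
waringList 18 5 = 199 ∷ []
waringList 18 6 = 7 ∷ 13 ∷ 109 ∷ 127 ∷ []
waringList 19 3 =
  343 ∷ 457 ∷ 571 ∷ 647 ∷ 761 ∷ 1103 ∷ 1217 ∷ 1483 ∷ 1559 ∷ 1597 ∷ 1787 ∷
  2053 ∷ 2129 ∷ 2357 ∷ 2927 ∷ []
waringList 19 4 = 191 ∷ 229 ∷ 419 ∷ []
waringList _ _ = []

{-# OPTIONS --safe #-}

-- Let d = gcd (k, q − 1). The k-th powers are the d-th powers, and the class map a ↦ a ^ ((q − 1) / d)
-- separates the d cosets of the group C of nonzero d-th powers: its values are the d-th roots of unity.
--
-- If q − 1 > d⁴, two d-th powers suffice. Suppose that a ≠ 0 is not a sum of two of them and put
-- A = C ∪ {0}. Then no line w = s z + b with s , b ∈ A meets A × aC. But two points with distinct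
-- abscissae lie on exactly one line, so the number of incidences of a line with A × aC has small
-- variance, and this forces |A|³ |aC| ≤ q³.
--
-- If q − 1 ≤ d⁴, compute in 𝔽ₚ or in an explicit 𝔽ₚ[x]/(xⁿ − f), mapped into the abstract field by means
-- of a root of xⁿ − f. Up to multiplication by d-th powers, the sums of n + 1 powers are the sums of n
-- powers and the elements 1 + u h with h ∈ C and u in a list representing the classes of sums of n
-- powers. So the classes reached with n powers are found by iteration.
module Submission where

open import Algebra.Apartness.Bundles using (HeytingField; HeytingCommutativeRing)
open import Algebra.Bundles using (CommutativeRing; RawRing)
open import Algebra.Core using (Op₁; Op₂)
open import Algebra.Morphism.Structures using (IsRingMonomorphism)
import Algebra.Morphism.RingMonomorphism as RingMonomorphism
import Algebra.Properties.CommutativeMonoid.Sum as CMSum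
import Algebra.Properties.CommutativeSemiring.Exp
import Algebra.Properties.Ring
import Algebra.Properties.Semiring.Exp
import Algebra.Properties.Semiring.Mult
import Algebra.Solver.Ring.NaturalCoefficients.Default as NatCoeffSolver
open import Algebra.Structures using (IsCommutativeRing)
open import Data.Bool.Base using (Bool; true; false; if_then_else_; _∧_; _∨_; not; T)
open import Data.Empty using (⊥-elim)
open import Data.Fin.Base using (Fin; zero; suc; toℕ; punchIn; inject≤)
open import Data.Fin.Permutation using (Permutation′; permutation)
import Data.Fin.Properties as Fin
open import Data.List.Base using (List; []; _∷_; length; lookup; map; concatMap; foldr; _++_)
open import Data.List.Membership.Propositional using (_∈_)
open import Data.List.Membership.Propositional.Properties using (∈-map⁺; ∈-concatMap⁺)
import Data.List.Properties as List
open import Data.List.Relation.Unary.All using (All; []; _∷_)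
import Data.List.Relation.Unary.All as All
import Data.List.Relation.Unary.All.Properties as All
open import Data.List.Relation.Unary.Any using (Any; here; there)
import Data.List.Relation.Unary.Any as Any
import Data.List.Relation.Unary.Any.Properties as Any
open import Data.Nat.Base as ℕ
  using (ℕ; zero; suc; pred; _≤_; _<_; z≤n; s≤s; _≡ᵇ_; _<ᵇ_; _≤ᵇ_; _%_; _/_)
open import Data.Nat.Coprimality using (prime⇒coprime; coprime-Bézout)
open import Data.Nat.Divisibility using (_∣_; divides; m%n≡0⇒n∣m; ∣⇒≤)
open import Data.Nat.DivMod using (m≡m%n+[m/n]*n; m*n/n≡m; m*n%n≡0)
open import Data.Nat.GCD using (gcd; gcd-GCD; gcd[m,n]∣m; gcd[m,n]∣n; gcd[m,n]≢0; module Bézout)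
open import Data.Nat.Primality using (Prime; composite; prime)
import Data.Nat.Properties as ℕ
open import Algebra.Properties.Semiring.Sum ℕ.+-*-semiring as ∑ using (sum)
open import Data.Nat.Solver using (module +-*-Solver)
open import Data.Product.Base using (∃; ∃₂; _×_; _,_; proj₁; proj₂)
open import Data.Sum.Base using (_⊎_; inj₁; inj₂; [_,_]′)
open import Data.Unit.Base using (tt)
open import Data.Vec.Base using (Vec; []; _∷_)
open import Data.Vec.Functional as Vector using (removeAt)
open import Function.Base using (_∘_; id; const)
open import Function.Bundles using (_⇔_; mk⇔; Inverse)
open import Level using (0ℓ)
open import Relation.Binary.Definitions using (tri<; tri≈; tri>)
open import Relation.Binary.PropositionalEquality
open import Relation.Nullary
open import Relation.Nullary.Decidable using (dec-true; dec-false)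
open import Defs

-- The threshold arises from `|A| ≥ q / d` and `|aC| ≥ (q − 1) / d`, which turn `|A|³ |aC| ≤ q³`
-- into `q − 1 ≤ d⁴`. This is the order of magnitude that character sums give, obtained by counting
-- alone. What remains are 36100 pairs `(d , (q − 1) / d)` with `d ≤ 19`, settled by evaluation. The
-- checks are therefore one-sided: `true` proves the claim, `false` proves nothing. In most fields
-- two powers suffice, and a sample of d-th powers already reaches all classes. Only the listed
-- orders need the full iteration, because a lower bound has to account for every sum: if fewer than
-- d classes occur among the sums of `j − 1` powers, then `j − 1` powers do not suffice. Neither a
-- primitive root nor the uniqueness of the field of order q is presupposed. Generators are tested
-- by evaluation, and residues and roots come from the bound on the number of roots of a monic
-- polynomial.

record FiniteField (m : ℕ) : Set where
  infixl 7 _*_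
  infixl 6 _+_
  infix 8 -_
  field
    _+_ _*_           : Op₂ (Fin (suc m))
    -_                : Op₁ (Fin (suc m))
    0# 1#             : Fin (suc m)
    isCommutativeRing : IsCommutativeRing _≡_ _+_ _*_ -_ 0# 1#
    0≢1               : 0# ≢ 1#
    inverse           : ∀ x → x ≢ 0# → ∃ λ y → x * y ≡ 1#

  commutativeRing : CommutativeRing 0ℓ 0ℓ
  commutativeRing = record { isCommutativeRing = isCommutativeRing }

-- Arithmetic of a finite field

module FieldTheory {m} (𝔽 : FiniteField m) where
  open FiniteField 𝔽 public using (0≢1; inverse)
  open CommutativeRing (FiniteField.commutativeRing 𝔽) public
    using (_+_; _*_; -_; 0#; 1#; semiring; commutativeSemiring; ring;
           +-commutativeMonoid; *-commutativeMonoid;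
           +-identityˡ; +-identityʳ; *-identityˡ; *-identityʳ; *-comm; *-assoc; +-comm; +-assoc;
           zeroˡ; zeroʳ; -‿inverseˡ; -‿inverseʳ; distribˡ; distribʳ)
  open Algebra.Properties.CommutativeSemiring.Exp commutativeSemiring public
  open Algebra.Properties.Ring ring public using (+-cancelˡ; +-cancelʳ)
  open Algebra.Properties.Semiring.Mult semiring public
    using () renaming (_×_ to _·_; ×-homo-+ to ·-homo-+; ×1-homo-* to ·1-homo-*)
  module 𝔽-Solver = NatCoeffSolver commutativeSemiring
  open 𝔽-Solver using (solve; _:=_; _:+_; _:*_)
  open ≡-Reasoning
  private
    module ∑ᶠ = CMSum +-commutativeMonoid
    module ∏ᶠ = CMSum *-commutativeMonoid

  A : Set
  A = Fin (suc m)

  infix 4 _≟_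
  _≟_ : (x y : A) → Dec (x ≡ y)
  _≟_ = Fin._≟_

  *-cancelˡ : ∀ {x y z} → x ≢ 0# → x * y ≡ x * z → y ≡ z
  *-cancelˡ {x} {y} {z} x≢0 xy≡xz with i , xi≡1 ← inverse x x≢0 = begin
    y             ≡⟨ *-identityˡ y ⟨
    1# * y        ≡⟨ cong (_* y) xi≡1 ⟨
    x * i * y     ≡⟨ solve 3 (λ x i y → x :* i :* y := i :* (x :* y)) refl x i y ⟩
    i * (x * y)   ≡⟨ cong (i *_) xy≡xz ⟩
    i * (x * z)   ≡⟨ solve 3 (λ x i y → i :* (x :* y) := x :* i :* y) refl x i z ⟩
    x * i * z     ≡⟨ cong (_* z) xi≡1 ⟩
    1# * z        ≡⟨ *-identityˡ z ⟩
    z             ∎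

  *-cancelʳ : ∀ {x y z} → x ≢ 0# → y * x ≡ z * x → y ≡ z
  *-cancelʳ {x} {y} {z} x≢0 eq =
    *-cancelˡ x≢0 (trans (*-comm x y) (trans eq (*-comm z x)))

  integral : ∀ {x y} → x ≢ 0# → y ≢ 0# → x * y ≢ 0#
  integral {x} x≢0 y≢0 xy≡0 = y≢0 (*-cancelˡ x≢0 (trans xy≡0 (sym (zeroʳ x))))

  ^-nonZero : ∀ {x} n → x ≢ 0# → x ^ n ≢ 0#
  ^-nonZero zero    x≢0 = 0≢1 ∘ sym
  ^-nonZero (suc n) x≢0 = integral x≢0 (^-nonZero n x≢0)

  1^ : ∀ n → 1# ^ n ≡ 1#
  1^ zero    = refl
  1^ (suc n) = trans (*-identityˡ _) (1^ n)

  0^ : ∀ n → 0# ^ suc n ≡ 0#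
  0^ n = zeroˡ _

  power-≡0 : ∀ {x} n → x ≡ 0# → x ^ suc n ≡ 0#
  power-≡0 n refl = 0^ n

  root-nonZero : ∀ {x} n → x ^ suc n ≡ 1# → x ≢ 0#
  root-nonZero n x^n≡1 refl = 0≢1 (trans (sym (0^ n)) x^n≡1)

  ^-comm : ∀ x i j → (x ^ i) ^ j ≡ (x ^ j) ^ i
  ^-comm x i j = begin
    (x ^ i) ^ j     ≡⟨ ^-assocʳ x i j ⟩
    x ^ (i ℕ.* j)   ≡⟨ cong (x ^_) (ℕ.*-comm i j) ⟩
    x ^ (j ℕ.* i)   ≡⟨ ^-assocʳ x j i ⟨
    (x ^ j) ^ i     ∎

  translation : A → Permutation′ (suc m)
  translation a = permutation (a +_) (- a +_) (λ x → cancel a (- a) x (-‿inverseʳ a))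
                                              (λ x → cancel (- a) a x (-‿inverseˡ a))
    where
    cancel : ∀ a b x → a + b ≡ 0# → a + (b + x) ≡ x
    cancel a b x eq = trans (sym (+-assoc a b x)) (trans (cong (_+ x) eq) (+-identityˡ x))

  scaling : ∀ a → a ≢ 0# → Permutation′ (suc m)
  scaling a a≢0 =
    permutation (a *_) (i *_) (λ x → cancel a i x ai≡1)
                              (λ x → cancel i a x (trans (*-comm i a) ai≡1))
    where
    i = proj₁ (inverse a a≢0)
    ai≡1 = proj₂ (inverse a a≢0)
    cancel : ∀ a b x → a * b ≡ 1# → a * (b * x) ≡ x
    cancel a b x eq = trans (sym (*-assoc a b x)) (trans (cong (_* x) eq) (*-identityˡ x))

  -- Adding 1 to every element permutes the field, so the sum of all elements is unchanged.
  order·1≡0 : suc m · 1# ≡ 0#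
  order·1≡0 = +-cancelʳ (∑ᶠ.sum id) _ _ (begin
    suc m · 1# + ∑ᶠ.sum id                        ≡⟨ cong (_+ ∑ᶠ.sum id) (∑ᶠ.sum-replicate (suc m)) ⟨
    ∑ᶠ.sum {suc m} (const 1#) + ∑ᶠ.sum id          ≡⟨ ∑ᶠ.∑-distrib-+ (const 1#) id ⟨
    ∑ᶠ.sum (1# +_)                                ≡⟨ ∑ᶠ.sum-permute id (translation 1#) ⟨
    ∑ᶠ.sum id                                     ≡⟨ +-identityˡ _ ⟨
    0# + ∑ᶠ.sum id                                ∎)

  private
    -- The value 1 at `y = 0` lets a product over the nonzero elements run over all of
    -- `Fin (suc m)`.
    atNonZero : A → A → A
    atNonZero x y = if does (y ≟ 0#) then 1# else x

    nonZeroPart : A → A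
    nonZeroPart y = atNonZero y y

    ∏-nonZero : ∀ {n} (f : Fin n → A) → (∀ i → f i ≢ 0#) → ∏ᶠ.sum f ≢ 0#
    ∏-nonZero {zero}  f f≢0 = 0≢1 ∘ sym
    ∏-nonZero {suc n} f f≢0 = integral (f≢0 zero) (∏-nonZero (f ∘ suc) (f≢0 ∘ suc))

    nonZeroPart-nonZero : ∀ y → nonZeroPart y ≢ 0#
    nonZeroPart-nonZero y with y ≟ 0#
    ... | yes _  = 0≢1 ∘ sym
    ... | no y≢0 = y≢0

    nonZeroPart-* : ∀ {x} → x ≢ 0# → ∀ y → nonZeroPart (x * y) ≡ atNonZero x y * nonZeroPart y
    nonZeroPart-* {x} x≢0 y with y ≟ 0# | x * y ≟ 0#
    ... | yes _    | yes _     = sym (*-identityˡ 1#)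
    ... | yes refl | no xy≢0   = ⊥-elim (xy≢0 (zeroʳ x))
    ... | no y≢0   | yes xy≡0  = ⊥-elim (integral x≢0 y≢0 xy≡0)
    ... | no _     | no _      = refl

    ∏-atNonZero : ∀ x → ∏ᶠ.sum (atNonZero x) ≡ x ^ m
    ∏-atNonZero x = begin
      ∏ᶠ.sum (atNonZero x)
        ≡⟨ ∏ᶠ.sum-remove {i = 0#} (atNonZero x) ⟩
      atNonZero x 0# * ∏ᶠ.sum (removeAt (atNonZero x) 0#)
        ≡⟨ cong₂ _*_ at-0 (∏ᶠ.sum-cong-≗ at-other) ⟩
      1# * ∏ᶠ.sum {m} (const x)
        ≡⟨ *-identityˡ _ ⟩
      ∏ᶠ.sum {m} (const x)
        ≡⟨ ∏ᶠ.sum-replicate m ⟩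
      x ^ m ∎
      where
      at-0 : atNonZero x 0# ≡ 1#
      at-0 with 0# ≟ 0#
      ... | yes _  = refl
      ... | no 0≢0 = ⊥-elim (0≢0 refl)
      at-other : ∀ i → removeAt (atNonZero x) 0# i ≡ x
      at-other i with punchIn 0# i ≟ 0#
      ... | yes eq = ⊥-elim (Fin.punchInᵢ≢i 0# i eq)
      ... | no _   = refl

  abstract
    -- Multiplication by `x` permutes the nonzero elements and multiplies their product by `x ^ m`.
    fermat : ∀ {x} → x ≢ 0# → x ^ m ≡ 1#
    fermat {x} x≢0 = *-cancelʳ (∏-nonZero nonZeroPart nonZeroPart-nonZero) (begin
      x ^ m * ∏ᶠ.sum nonZeroPart
        ≡⟨ cong (_* ∏ᶠ.sum nonZeroPart) (∏-atNonZero x) ⟨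
      ∏ᶠ.sum (atNonZero x) * ∏ᶠ.sum nonZeroPart
        ≡⟨ ∏ᶠ.∑-distrib-+ (atNonZero x) nonZeroPart ⟨
      ∏ᶠ.sum (λ y → atNonZero x y * nonZeroPart y)
        ≡⟨ ∏ᶠ.sum-cong-≗ (nonZeroPart-* x≢0) ⟨
      ∏ᶠ.sum (λ y → nonZeroPart (x * y))
        ≡⟨ ∏ᶠ.sum-permute nonZeroPart (scaling x x≢0) ⟨
      ∏ᶠ.sum nonZeroPart
        ≡⟨ *-identityˡ _ ⟨
      1# * ∏ᶠ.sum nonZeroPart ∎)

  -- Polynomial functions

  -- The Horner form of a monic polynomial of degree n, kept only as a function. One function may be
  -- monic of several degrees; the root bounds hold for each of them.
  Monic : ℕ → (A → A) → Set
  Monic zero    f = ∀ x → f x ≡ 1#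
  Monic (suc n) f = ∃₂ λ g c → Monic n g × (∀ x → f x ≡ x * g x + c)

  Monic-cong : ∀ {n f g} → (∀ x → f x ≡ g x) → Monic n f → Monic n g
  Monic-cong {zero}  f≗g monic             = λ x → trans (sym (f≗g x)) (monic x)
  Monic-cong {suc n} f≗g (h , c , monic , f≗) =
    h , c , monic , λ x → trans (sym (f≗g x)) (f≗ x)

  Monic-cast : ∀ {f i j} → i ≡ j → Monic i f → Monic j f
  Monic-cast refl monic = monic

  Monic-+const : ∀ {n f} → Monic (suc n) f → ∀ b → Monic (suc n) (λ x → f x + b)
  Monic-+const (g , c , monic , f≗) b =
    g , c + b , monic , λ x → trans (cong (_+ b) (f≗ x)) (+-assoc _ _ _)

  Monic-^* : ∀ k {n f} → Monic n f → Monic (k ℕ.+ n) (λ x → x ^ k * f x)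
  Monic-^* zero    monic = Monic-cong (λ x → sym (*-identityˡ _)) monic
  Monic-^* (suc k) monic =
    _ , 0# , Monic-^* k monic , λ x → trans (*-assoc _ _ _) (sym (+-identityʳ _))

  Monic-∘^ : ∀ k {n f} → Monic n f → Monic (suc k ℕ.* n) (λ x → f (x ^ suc k))
  Monic-∘^ k {zero} {f} monic =
    Monic-cast (sym (ℕ.*-zeroʳ k)) (λ x → monic (x ^ suc k))
  Monic-∘^ k {suc n} (g , c , monic , f≗) =
    Monic-cast (sym (ℕ.*-suc (suc k) n))
      (Monic-cong (λ x → sym (f≗ (x ^ suc k)))
        (Monic-+const (Monic-^* (suc k) (Monic-∘^ k monic)) c))

  Monic-^ : ∀ n → Monic n (_^ n)
  Monic-^ n = Monic-cong (λ x → *-identityʳ _)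
    (Monic-cast (ℕ.+-identityʳ n) (Monic-^* n {f = const 1#} (λ _ → refl)))

  -- f x − f a = (x − a) g x, with both sides moved so that no subtraction occurs.
  factor : ∀ {n f} → Monic (suc n) f → ∀ a →
           ∃ λ g → Monic n g × (∀ x → f x + a * g x ≡ x * g x + f a)
  factor {zero} (g , c , monic , f≗) a = g , monic , λ x → begin
    _ + a * g x               ≡⟨ cong₂ (λ u v → u + a * v) (f≗ x) (trans (monic x) (sym (monic a))) ⟩
    x * g x + c + a * g a     ≡⟨ solve 3 (λ u c v → u :+ c :+ v := u :+ (v :+ c)) refl (x * g x) c (a * g a) ⟩
    x * g x + (a * g a + c)   ≡⟨ cong (x * g x +_) (f≗ a) ⟨
    x * g x + _               ∎
  factor {suc n} {f} (g , c , monic , f≗) a with h , monic-h , eq ← factor monic a =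
    (λ x → x * h x + g a) , (h , g a , monic-h , λ _ → refl) , λ x → begin
      f x + a * (x * h x + g a)
        ≡⟨ cong (_+ a * (x * h x + g a)) (f≗ x) ⟩
      x * g x + c + a * (x * h x + g a)
        ≡⟨ solve 6 (λ x gx c a hx ga → x :* gx :+ c :+ a :* (x :* hx :+ ga)
                                    := x :* (gx :+ a :* hx) :+ (a :* ga :+ c))
             refl x (g x) c a (h x) (g a) ⟩
      x * (g x + a * h x) + (a * g a + c)
        ≡⟨ cong₂ (λ u v → x * u + v) (eq x) (sym (f≗ a)) ⟩
      x * (x * h x + g a) + f a ∎

  factor-root : ∀ {n f} → Monic (suc n) f → ∀ {a} → f a ≡ 0# →
                ∃ λ g → Monic n g × (∀ {x} → f x ≡ 0# → x ≢ a → g x ≡ 0#)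
  factor-root {f = f} monic {a} fa≡0 with g , monic-g , eq ← factor monic a =
    g , monic-g , λ {x} fx≡0 x≢a → decidable-stable (g x ≟ 0#) λ gx≢0 →
      x≢a (sym (*-cancelʳ gx≢0 (begin
        a * g x          ≡⟨ +-identityˡ _ ⟨
        0# + a * g x     ≡⟨ cong (_+ a * g x) fx≡0 ⟨
        f x + a * g x    ≡⟨ eq x ⟩
        x * g x + f a    ≡⟨ cong (x * g x +_) fa≡0 ⟩
        x * g x + 0#     ≡⟨ +-identityʳ _ ⟩
        x * g x          ∎)))

  roots-bound : ∀ {n f} → Monic n f → (r : Fin (suc n) → A) →
                (∀ {i j} → r i ≡ r j → i ≡ j) → ¬ (∀ i → f (r i) ≡ 0#)
  roots-bound {zero}  monic r r-inj roots = 0≢1 (trans (sym (roots zero)) (monic _))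
  roots-bound {suc n} monic r r-inj roots
    with g , monic-g , eq ← factor-root monic (roots zero) =
    roots-bound monic-g (r ∘ suc) (Fin.suc-injective ∘ r-inj)
      λ i → eq (roots (suc i)) λ r≡ → Fin.0≢1+n (sym (r-inj r≡))

  -- Stands in for a generator of the multiplicative group: residues and roots are found at a point
  -- where a quotient of small degree fails to vanish.
  nonZero-nonRoot : ∀ {n f} → n < m → Monic n f → ∃ λ x → x ≢ 0# × f x ≢ 0#
  nonZero-nonRoot {n} {f} n<m monic
    with Fin.any? (λ x → ¬? (x ≟ 0#) ×-dec ¬? (f x ≟ 0#))
  ... | yes found = found
  ... | no none   = ⊥-elim (roots-bound monic r r-inj λ i →
      decidable-stable (f (r i) ≟ 0#) λ fr≢0 → none (r i , (Fin.punchInᵢ≢i 0# _) , fr≢0))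
    where
    r : Fin (suc n) → A
    r i = punchIn 0# (inject≤ i n<m)
    r-inj : ∀ {i j} → r i ≡ r j → i ≡ j
    r-inj eq = Fin.inject≤-injective n<m n<m _ _ (Fin.punchIn-injective 0# _ _ eq)

  -- Roots of unity and power residues

  HasExactOrder : A → ℕ → Set
  HasExactOrder w n = w ^ n ≡ 1# × (∀ i → 0 < i → i < n → w ^ i ≢ 1#)

  powers-≢ : ∀ {w n} → HasExactOrder w n → ∀ {i j} → i < j → j < n → w ^ i ≢ w ^ j
  powers-≢ {w} {suc n} (w^n≡1 , minimal) {i} {j} i<j j<n eq =
    minimal (j ℕ.∸ i) (ℕ.m<n⇒0<n∸m i<j) (ℕ.≤-<-trans (ℕ.m∸n≤m j i) j<n)
      (*-cancelˡ (^-nonZero i (root-nonZero n w^n≡1)) (begin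
        w ^ i * w ^ (j ℕ.∸ i)   ≡⟨ ^-homo-* w i (j ℕ.∸ i) ⟨
        w ^ (i ℕ.+ (j ℕ.∸ i))   ≡⟨ cong (w ^_) (ℕ.m+[n∸m]≡n (ℕ.<⇒≤ i<j)) ⟩
        w ^ j                   ≡⟨ eq ⟨
        w ^ i                   ≡⟨ *-identityʳ _ ⟨
        w ^ i * 1#              ∎))

  powers-injective : ∀ {w n} → HasExactOrder w n → ∀ {i j} → i < n → j < n →
                     w ^ i ≡ w ^ j → i ≡ j
  powers-injective exact {i} {j} i<n j<n eq with ℕ.<-cmp i j
  ... | tri≈ _ i≡j _ = i≡j
  ... | tri< i<j _ _ = ⊥-elim (powers-≢ exact i<j j<n eq)
  ... | tri> _ _ j<i = ⊥-elim (powers-≢ exact j<i i<n (sym eq))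

  abstract
    -- The powers of `w` already supply `suc n` distinct roots of `X ^ suc n − 1`; an `a` outside
    -- them would be one root too many.
    unity-root-power : ∀ {w n a} → HasExactOrder w (suc n) → a ^ suc n ≡ 1# →
                       ∃ λ i → i < suc n × a ≡ w ^ i
    unity-root-power {w} {n} {a} exact@(w^n≡1 , _) a^n≡1
      with Fin.any? {n = suc n} (λ i → a ≟ w ^ toℕ i)
    ... | yes (i , a≡) = toℕ i , Fin.toℕ<n i , a≡
    ... | no none = ⊥-elim (roots-bound (Monic-+const (Monic-^ (suc n)) (- 1#)) r r-inj r-root)
      where
      r : Fin (suc (suc n)) → A
      r zero    = a
      r (suc i) = w ^ toℕ i
      r-inj : ∀ {i j} → r i ≡ r j → i ≡ j
      r-inj {zero}  {zero}  _  = refl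
      r-inj {zero}  {suc j} eq = ⊥-elim (none (j , eq))
      r-inj {suc i} {zero}  eq = ⊥-elim (none (i , sym eq))
      r-inj {suc i} {suc j} eq = cong suc (Fin.toℕ-injective
        (powers-injective exact (Fin.toℕ<n i) (Fin.toℕ<n j) eq))
      r-root : ∀ i → r i ^ suc n + - 1# ≡ 0#
      r-root zero    = trans (cong (_+ - 1#) a^n≡1) (-‿inverseʳ 1#)
      r-root (suc i) = trans (cong (_+ - 1#) (begin
        (w ^ toℕ i) ^ suc n   ≡⟨ ^-comm w (toℕ i) (suc n) ⟩
        (w ^ suc n) ^ toℕ i   ≡⟨ cong (_^ toℕ i) w^n≡1 ⟩
        1# ^ toℕ i            ≡⟨ 1^ (toℕ i) ⟩
        1#                    ∎)) (-‿inverseʳ 1#)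

  -- `f` is the quotient of `X ^ suc n − a ^ suc n` by `X − a`, again written without subtraction.
  geometric : ∀ a n → ∃ λ f → Monic n f × (∀ x → x ^ suc n + a * f x ≡ x * f x + a ^ suc n)
  geometric a zero = const 1# , (λ _ → refl) , λ x → cong (x * 1# +_) refl
  geometric a (suc n) with f , monic , eq ← geometric a n =
    (λ x → x * f x + a ^ suc n) , (f , a ^ suc n , monic , λ _ → refl) , λ x → begin
      x * x ^ suc n + a * (x * f x + a ^ suc n)
        ≡⟨ solve 5 (λ x p a fx b → x :* p :+ a :* (x :* fx :+ b)
                                := x :* (p :+ a :* fx) :+ a :* b)
             refl x (x ^ suc n) a (f x) (a ^ suc n) ⟩
      x * (x ^ suc n + a * f x) + a * a ^ suc n
        ≡⟨ cong (λ u → x * u + a * a ^ suc n) (eq x) ⟩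
      x * (x * f x + a ^ suc n) + a * a ^ suc n ∎

  -- Otherwise (X ^ e − 1) / (X − a), evaluated at X = x ^ d, would have degree d (e − 1) < m
  -- and vanish at all m nonzero x.
  abstract
    power-residue : ∀ {d e a} → suc d ℕ.* suc e ≡ m → a ^ suc e ≡ 1# → ∃ λ x → a ≡ x ^ suc d
    power-residue {d} {e} {a} de≡m a^e≡1 with Fin.any? (λ x → a ≟ x ^ suc d)
    ... | yes found = found
    ... | no none with f , monic , eq ← geometric a e
      with x , x≢0 , fx≢0 ← nonZero-nonRoot (subst (suc d ℕ.* e <_) de≡m
                              (ℕ.*-monoʳ-< (suc d) (ℕ.n<1+n e))) (Monic-∘^ d monic)
      = ⊥-elim (none (x , *-cancelʳ fx≢0 (+-cancelˡ 1# _ _ (begin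
          1# + a * f y            ≡⟨ cong (_+ a * f y) y^e≡1 ⟨
          y ^ suc e + a * f y     ≡⟨ eq y ⟩
          y * f y + a ^ suc e     ≡⟨ +-comm _ _ ⟩
          a ^ suc e + y * f y     ≡⟨ cong (_+ y * f y) a^e≡1 ⟩
          1# + y * f y            ∎))))
      where
      y : A
      y = x ^ suc d
      y^e≡1 : y ^ suc e ≡ 1#
      y^e≡1 = trans (^-assocʳ x (suc d) (suc e)) (trans (cong (x ^_) de≡m) (fermat x≢0))

-- Sums of natural numbers over finite types

sum-mono-≤ : ∀ {n} {f g : Fin n → ℕ} → (∀ i → f i ≤ g i) → sum f ≤ sum g
sum-mono-≤ {zero}  f≤g = z≤n
sum-mono-≤ {suc n} f≤g = ℕ.+-mono-≤ (f≤g zero) (sum-mono-≤ (f≤g ∘ suc))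

sum-const : ∀ n x → sum {n} (const x) ≡ n ℕ.* x
sum-const zero    x = refl
sum-const (suc n) x = cong (x ℕ.+_) (sum-const n x)

sum₂-cong : ∀ {k n} {f g : Fin k → Fin n → ℕ} → (∀ i j → f i j ≡ g i j) →
            sum (λ i → sum (f i)) ≡ sum (λ i → sum (g i))
sum₂-cong f≗g = ∑.sum-cong-≗ (∑.sum-cong-≗ ∘ f≗g)

sum₂-distrib-+ : ∀ {k n} (f g : Fin k → Fin n → ℕ) →
                 sum (λ i → sum (λ j → f i j ℕ.+ g i j))
                 ≡ sum (λ i → sum (f i)) ℕ.+ sum (λ i → sum (g i))
sum₂-distrib-+ f g = trans (∑.sum-cong-≗ λ i → ∑.∑-distrib-+ (f i) (g i))
                           (∑.∑-distrib-+ (λ i → sum (f i)) (λ i → sum (g i)))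

*-distribˡ-sum₂ : ∀ {k n} x (f : Fin k → Fin n → ℕ) →
                  x ℕ.* sum (λ i → sum (f i)) ≡ sum (λ i → sum (λ j → x ℕ.* f i j))
*-distribˡ-sum₂ x f = trans (∑.*-distribˡ-sum x (λ i → sum (f i)))
                            (∑.sum-cong-≗ λ i → ∑.*-distribˡ-sum x (f i))

sum-*-sum : ∀ {k n} (f : Fin k → ℕ) (g : Fin n → ℕ) →
            sum f ℕ.* sum g ≡ sum (λ i → sum (λ j → f i ℕ.* g j))
sum-*-sum f g = trans (∑.*-distribʳ-sum (sum g) f) (∑.sum-cong-≗ λ i → ∑.*-distribˡ-sum (f i) g)

sum-rotate : ∀ {k l n} (f : Fin k → Fin l → Fin n → ℕ) →
             sum (λ i → sum (λ j → sum (f i j))) ≡ sum (λ j → sum (λ h → sum (λ i → f i j h)))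
sum-rotate f = trans (∑.∑-comm (λ i j → sum (f i j))) (∑.sum-cong-≗ λ j → ∑.∑-comm (λ i → f i j))

𝟙 : ∀ {P : Set} → Dec P → ℕ
𝟙 P? = if does P? then 1 else 0

𝟙-yes : ∀ {P : Set} (P? : Dec P) → P → 𝟙 P? ≡ 1
𝟙-yes P? p = cong (if_then 1 else 0) (dec-true P? p)

𝟙-no : ∀ {P : Set} (P? : Dec P) → ¬ P → 𝟙 P? ≡ 0
𝟙-no P? ¬p = cong (if_then 1 else 0) (dec-false P? ¬p)

𝟙-mono : ∀ {P Q : Set} (P? : Dec P) (Q? : Dec Q) → (P → Q) → 𝟙 P? ≤ 𝟙 Q?
𝟙-mono (no _)  Q? P⇒Q = z≤n
𝟙-mono (yes p) Q? P⇒Q = ℕ.≤-reflexive (sym (𝟙-yes Q? (P⇒Q p)))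

𝟙≤1 : ∀ {P : Set} (P? : Dec P) → 𝟙 P? ≤ 1
𝟙≤1 (yes _) = ℕ.≤-refl
𝟙≤1 (no _)  = z≤n

𝟙-idem : ∀ {P : Set} (P? : Dec P) → 𝟙 P? ℕ.* 𝟙 P? ≡ 𝟙 P?
𝟙-idem (yes _) = refl
𝟙-idem (no _)  = refl

sum-𝟙≟ : ∀ {n} (i : Fin n) (f : Fin n → ℕ) → sum (λ j → 𝟙 (j Fin.≟ i) ℕ.* f j) ≡ f i
sum-𝟙≟ {suc n} i f = begin
  sum t                                  ≡⟨ ∑.sum-remove {i = i} t ⟩
  t i ℕ.+ sum (removeAt t i)             ≡⟨ cong₂ ℕ._+_ (cong (ℕ._* f i) (𝟙-yes (i Fin.≟ i) refl))
                                               (∑.sum-cong-≗ λ j → cong (ℕ._* f (punchIn i j))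
                                                 (𝟙-no (punchIn i j Fin.≟ i) (Fin.punchInᵢ≢i i j))) ⟩
  1 ℕ.* f i ℕ.+ sum {n} (const 0)        ≡⟨ cong₂ ℕ._+_ (ℕ.*-identityˡ (f i)) (trans (sum-const n 0) (ℕ.*-zeroʳ n)) ⟩
  f i ℕ.+ 0                              ≡⟨ ℕ.+-identityʳ (f i) ⟩
  f i                                    ∎
  where
  open ≡-Reasoning
  t = λ j → 𝟙 (j Fin.≟ i) ℕ.* f j

am-gm : ∀ u v → 2 ℕ.* (u ℕ.* v) ≤ u ℕ.* u ℕ.+ v ℕ.* v
am-gm u v with ℕ.≤-total u v
... | inj₁ u≤v with k , refl ← ℕ.m≤n⇒∃[o]m+o≡n u≤v = subst (2 ℕ.* (u ℕ.* (u ℕ.+ k)) ≤_)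
  (solve 2 (λ u k → con 2 :* (u :* (u :+ k)) :+ k :* k := u :* u :+ (u :+ k) :* (u :+ k)) refl u k)
  (ℕ.m≤m+n _ (k ℕ.* k))
  where open +-*-Solver
am-gm u v | inj₂ v≤u with k , refl ← ℕ.m≤n⇒∃[o]m+o≡n v≤u = subst (2 ℕ.* ((v ℕ.+ k) ℕ.* v) ≤_)
  (solve 2 (λ v k → con 2 :* ((v :+ k) :* v) :+ k :* k := (v :+ k) :* (v :+ k) :+ v :* v) refl v k)
  (ℕ.m≤m+n _ (k ℕ.* k))
  where open +-*-Solver

-- Sums of k-th powers

module PowerSums {m} (𝔽 : FiniteField m) where
  open FieldTheory 𝔽

  Sum : ℕ → ℕ → A → Set
  Sum k zero    a = a ≡ 0#
  Sum k (suc n) a = ∃₂ λ x b → Sum k n b × a ≡ x ^ k + b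

  Covers : ℕ → ℕ → Set
  Covers k n = ∀ a → Sum k n a

  module _ {d : ℕ} where
    Sum-suc : ∀ n {a} → Sum (suc d) n a → Sum (suc d) (suc n) a
    Sum-suc n {a} a∈Sₙ = 0# , a , a∈Sₙ , sym (trans (cong (_+ a) (0^ d)) (+-identityˡ a))

    Sum-0 : ∀ n → Sum (suc d) n 0#
    Sum-0 zero    = refl
    Sum-0 (suc n) = Sum-suc n (Sum-0 n)

    Sum-≡0 : ∀ n {a} → a ≡ 0# → Sum (suc d) n a
    Sum-≡0 n a≡0 = subst (Sum (suc d) n) (sym a≡0) (Sum-0 n)

    Sum-≤ : ∀ {i j} → i ℕ.≤′ j → ∀ {a} → Sum (suc d) i a → Sum (suc d) j a
    Sum-≤ ℕ.≤′-refl       a∈Sᵢ = a∈Sᵢ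
    Sum-≤ (ℕ.≤′-step i≤j) a∈Sᵢ = Sum-suc _ (Sum-≤ i≤j a∈Sᵢ)

  -- The incidence bound

  roots-count : ∀ {n f} → Monic n f → sum (λ x → 𝟙 (f x ≟ 0#)) ≤ n
  roots-count {n} {f} monic with Fin.any? (λ x → f x ≟ 0#)
  roots-count {n} {f} monic | no none = ℕ.≤-trans (ℕ.≤-reflexive (trans
      (∑.sum-cong-≗ λ x → 𝟙-no (f x ≟ 0#) (λ fx≡0 → none (x , fx≡0)))
      (trans (sum-const (suc m) 0) (ℕ.*-zeroʳ (suc m))))) z≤n
  roots-count {zero}  {f} monic | yes (a , fa≡0) = ⊥-elim (0≢1 (trans (sym fa≡0) (monic a)))
  roots-count {suc n} {f} monic | yes (a , fa≡0) with g , monic-g , divide ← factor-root monic fa≡0 = begin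
    sum (λ x → 𝟙 (f x ≟ 0#))
      ≤⟨ sum-mono-≤ pointwise ⟩
    sum (λ x → 𝟙 (x ≟ a) ℕ.* 1 ℕ.+ 𝟙 (g x ≟ 0#))
      ≡⟨ ∑.∑-distrib-+ (λ x → 𝟙 (x ≟ a) ℕ.* 1) (λ x → 𝟙 (g x ≟ 0#)) ⟩
    sum (λ x → 𝟙 (x ≟ a) ℕ.* 1) ℕ.+ sum (λ x → 𝟙 (g x ≟ 0#))
      ≤⟨ ℕ.+-mono-≤ (ℕ.≤-reflexive (sum-𝟙≟ a (const 1))) (roots-count monic-g) ⟩
    suc n ∎
    where
    open ℕ.≤-Reasoning
    pointwise : ∀ x → 𝟙 (f x ≟ 0#) ≤ 𝟙 (x ≟ a) ℕ.* 1 ℕ.+ 𝟙 (g x ≟ 0#)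
    pointwise x with x ≟ a
    ... | yes _  = ℕ.≤-trans (𝟙≤1 (f x ≟ 0#)) (ℕ.m≤m+n 1 _)
    ... | no x≢a = 𝟙-mono (f x ≟ 0#) (g x ≟ 0#) (λ fx≡0 → divide fx≡0 x≢a)

  -- Each `w` has at most `suc d` preimages under `x ↦ x ^ suc d`, the roots of `X ^ suc d − w`.
  powers-count : ∀ d (p r : A → ℕ) → (∀ x → p x ≤ r (x ^ suc d)) → sum p ≤ suc d ℕ.* sum r
  powers-count d p r p≤r = begin
    sum p
      ≤⟨ sum-mono-≤ p≤r ⟩
    sum (λ x → r (x ^ suc d))
      ≡⟨ ∑.sum-cong-≗ (λ x → sum-𝟙≟ (x ^ suc d) r) ⟨
    sum (λ x → sum (λ w → 𝟙 (w ≟ x ^ suc d) ℕ.* r w))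
      ≡⟨ ∑.∑-comm (λ x w → 𝟙 (w ≟ x ^ suc d) ℕ.* r w) ⟩
    sum (λ w → sum (λ x → 𝟙 (w ≟ x ^ suc d) ℕ.* r w))
      ≡⟨ ∑.sum-cong-≗ (λ w → ∑.*-distribʳ-sum (r w) (λ x → 𝟙 (w ≟ x ^ suc d))) ⟨
    sum (λ w → sum (λ x → 𝟙 (w ≟ x ^ suc d)) ℕ.* r w)
      ≤⟨ sum-mono-≤ (λ w → ℕ.*-monoˡ-≤ (r w) (fibre w)) ⟩
    sum (λ w → suc d ℕ.* r w)
      ≡⟨ ∑.*-distribˡ-sum (suc d) r ⟨
    suc d ℕ.* sum r ∎
    where
    open ℕ.≤-Reasoning
    fibre : ∀ w → sum (λ x → 𝟙 (w ≟ x ^ suc d)) ≤ suc d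
    fibre w = ℕ.≤-trans
      (sum-mono-≤ λ x → 𝟙-mono (w ≟ x ^ suc d) (x ^ suc d + - w ≟ 0#)
        λ w≡ → trans (cong (_+ - w) (sym w≡)) (-‿inverseʳ w))
      (roots-count (Monic-+const (Monic-^ (suc d)) (- w)))

  module Incidence {d} (0<m : 0 < m) {a : A} (a≢0 : a ≢ 0#) (a∉S₂ : ¬ Sum (suc d) 2 a) where
    private
      k q : ℕ
      k = suc d
      q = suc m

    abstract
      power? : ∀ z → Dec (∃ λ x → z ≡ x ^ k)
      power? z = Fin.any? λ x → z ≟ x ^ k

      coset? : ∀ w → Dec (∃ λ x → x ≢ 0# × w ≡ a * x ^ k)
      coset? w = Fin.any? λ x → ¬? (x ≟ 0#) ×-dec (w ≟ a * x ^ k)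

    -- `α` marks the set of all k-th powers including 0 (not to be confused with the carrier `A`),
    -- and `κ` marks the coset of `a`, which omits 0.
    α κ : A → ℕ
    α z = 𝟙 (power? z)
    κ w = 𝟙 (coset? w)

    n c : ℕ
    n = sum α
    c = sum κ

    q≤kn : q ≤ k ℕ.* n
    q≤kn = begin
      q                    ≡⟨ ℕ.*-identityʳ q ⟨
      q ℕ.* 1              ≡⟨ sum-const q 1 ⟨
      sum {q} (const 1)    ≤⟨ powers-count d (const 1) α (λ x → ℕ.≤-reflexive (sym (𝟙-yes (power? (x ^ k)) (x , refl)))) ⟩
      k ℕ.* n              ∎
      where open ℕ.≤-Reasoning

    m≤kc : m ≤ k ℕ.* c
    m≤kc = begin
      m                             ≡⟨ ∑nonZero ⟨
      sum (λ x → 𝟙 (¬? (x ≟ 0#)))   ≤⟨ powers-count d (λ x → 𝟙 (¬? (x ≟ 0#))) (κ ∘ (a *_)) (λ x → 𝟙-mono (¬? (x ≟ 0#)) (coset? (a * x ^ k)) (λ x≢0 → x , x≢0 , refl)) ⟩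
      k ℕ.* sum (κ ∘ (a *_))        ≡⟨ cong (k ℕ.*_) (∑.sum-permute κ (scaling a a≢0)) ⟨
      k ℕ.* c                       ∎
      where
      open ℕ.≤-Reasoning
      ∑nonZero : sum (λ x → 𝟙 (¬? (x ≟ 0#))) ≡ m
      ∑nonZero = trans (∑.sum-remove {i = 0#} (λ x → 𝟙 (¬? (x ≟ 0#))))
        (cong₂ ℕ._+_ (𝟙-no (¬? (0# ≟ 0#)) (λ 0≢0 → 0≢0 refl))
          (trans (∑.sum-cong-≗ λ i → 𝟙-yes (¬? (punchIn 0# i ≟ 0#)) (Fin.punchInᵢ≢i 0# i))
            (trans (sum-const m 1) (ℕ.*-identityʳ m))))

    -- The number of incidences of the line w = s z + b with the points (z , w) of A × a C,
    -- where C is the set of nonzero k-th powers and A = C ∪ {0}.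
    I : A → A → ℕ
    I s b = sum λ z → α z ℕ.* κ (s * z + b)

    ∑κ-translate : ∀ t → sum (λ b → κ (t + b)) ≡ c
    ∑κ-translate t = sym (∑.sum-permute κ (translation t))

    ∑I : ∀ s → sum (I s) ≡ n ℕ.* c
    ∑I s = begin
      sum (λ b → sum (λ z → α z ℕ.* κ (s * z + b)))
        ≡⟨ ∑.∑-comm (λ b z → α z ℕ.* κ (s * z + b)) ⟩
      sum (λ z → sum (λ b → α z ℕ.* κ (s * z + b)))
        ≡⟨ ∑.sum-cong-≗ (λ z → trans (sym (∑.*-distribˡ-sum (α z) (λ b → κ (s * z + b))))
                                     (cong (α z ℕ.*_) (∑κ-translate (s * z)))) ⟩
      sum (λ z → α z ℕ.* c)
        ≡⟨ ∑.*-distribʳ-sum c α ⟨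
      n ℕ.* c ∎
      where open ≡-Reasoning

    -- An incidence would be an equation `x ^ k * v ^ k + y ^ k ≡ a * w ^ k` with `w ≢ 0#`; dividing
    -- it by `w ^ k` makes `a` a sum of two powers.
    I-vanishes : ∀ {s b} → (∃ λ x → s ≡ x ^ k) → (∃ λ x → b ≡ x ^ k) → I s b ≡ 0
    I-vanishes {s} {b} (x , s≡) (y , b≡) =
      trans (∑.sum-cong-≗ term) (trans (sum-const q 0) (ℕ.*-zeroʳ q))
      where
      term : ∀ z → α z ℕ.* κ (s * z + b) ≡ 0
      term z with power? z
      ... | no _ = refl
      ... | yes (v , z≡) = trans (ℕ.+-identityʳ _) (𝟙-no (coset? (s * z + b)) λ (w , w≢0 , eq) →
          let i , wi≡1 = inverse w w≢0 in
          a∉S₂ (x * v * i , _ , (y * i , 0# , refl , refl) , (begin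
            a                                      ≡⟨ *-identityʳ a ⟨
            a * 1#                                 ≡⟨ cong (a *_) (trans (cong (_^ k) wi≡1) (1^ k)) ⟨
            a * (w * i) ^ k                        ≡⟨ cong (a *_) (^-distrib-* w i k) ⟩
            a * (w ^ k * i ^ k)                    ≡⟨ *-assoc a _ _ ⟨
            a * w ^ k * i ^ k                      ≡⟨ cong (_* i ^ k) eq ⟨
            (s * z + b) * i ^ k                    ≡⟨ cong₂ (λ u v → (u + v) * i ^ k) (cong₂ _*_ s≡ z≡) b≡ ⟩
            (x ^ k * v ^ k + y ^ k) * i ^ k        ≡⟨ distribʳ _ _ _ ⟩
            x ^ k * v ^ k * i ^ k + y ^ k * i ^ k  ≡⟨ cong₂ _+_ (trans (cong (_* i ^ k) (sym (^-distrib-* x v k)))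
                                                                       (sym (^-distrib-* (x * v) i k)))
                                                               (sym (^-distrib-* y i k)) ⟩
            (x * v * i) ^ k + (y * i) ^ k          ≡⟨ cong ((x * v * i) ^ k +_) (+-identityʳ _) ⟨
            (x * v * i) ^ k + ((y * i) ^ k + 0#)   ∎)))
          where open ≡-Reasoning

    pairs : A → A → ℕ
    pairs z z′ = sum λ s → sum λ b → κ (s * z + b) ℕ.* κ (s * z′ + b)

    -- For z ≠ z′, exactly one line takes prescribed values at z and z′.
    pairs≤ : ∀ z z′ → pairs z z′ ≤ c ℕ.* c ℕ.+ 𝟙 (z′ ≟ z) ℕ.* (q ℕ.* c)
    pairs≤ z z′ with z′ ≟ z
    ... | yes refl = begin
      pairs z z
        ≡⟨ sum₂-cong (λ s b → 𝟙-idem (coset? (s * z + b))) ⟩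
      sum (λ s → sum (λ b → κ (s * z + b)))
        ≡⟨ ∑.sum-cong-≗ (λ s → ∑κ-translate (s * z)) ⟩
      sum {q} (const c)
        ≡⟨ sum-const q c ⟩
      q ℕ.* c
        ≡⟨ ℕ.+-identityʳ _ ⟨
      1 ℕ.* (q ℕ.* c)
        ≤⟨ ℕ.m≤n+m _ (c ℕ.* c) ⟩
      c ℕ.* c ℕ.+ 1 ℕ.* (q ℕ.* c) ∎
      where open ℕ.≤-Reasoning
    ... | no z′≢z = begin
      pairs z z′
        ≡⟨ sum₂-cong (λ s b → cong (λ u → κ (s * z + b) ℕ.* κ u) (shear s b)) ⟩
      sum (λ s → sum (λ b → κ (s * z + b) ℕ.* κ (δ * s + (s * z + b))))
        ≡⟨ ∑.sum-cong-≗ (λ s → ∑.sum-permute (λ w → κ w ℕ.* κ (δ * s + w)) (translation (s * z))) ⟨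
      sum (λ s → sum (λ w → κ w ℕ.* κ (δ * s + w)))
        ≡⟨ ∑.∑-comm (λ s w → κ w ℕ.* κ (δ * s + w)) ⟩
      sum (λ w → sum (λ s → κ w ℕ.* κ (δ * s + w)))
        ≡⟨ ∑.sum-cong-≗ (λ w → ∑.*-distribˡ-sum (κ w) (λ s → κ (δ * s + w))) ⟨
      sum (λ w → κ w ℕ.* sum (λ s → κ (δ * s + w)))
        ≡⟨ ∑.sum-cong-≗ (λ w → cong (κ w ℕ.*_) (trans
             (sym (∑.sum-permute (λ s → κ (s + w)) (scaling δ δ≢0)))
             (trans (∑.sum-cong-≗ λ s → cong κ (+-comm s w)) (∑κ-translate w)))) ⟩
      sum (λ w → κ w ℕ.* c)
        ≡⟨ ∑.*-distribʳ-sum c κ ⟨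
      c ℕ.* c
        ≡⟨ ℕ.+-identityʳ _ ⟨
      c ℕ.* c ℕ.+ 0 ∎
      where
      open ℕ.≤-Reasoning
      δ : A
      δ = z′ + - z
      z′≡ : z′ ≡ z + δ
      z′≡ = sym (trans (cong (z +_) (+-comm z′ (- z))) (trans (sym (+-assoc z (- z) z′))
              (trans (cong (_+ z′) (-‿inverseʳ z)) (+-identityˡ z′))))
      δ≢0 : δ ≢ 0#
      δ≢0 δ≡0 = z′≢z (trans z′≡ (trans (cong (z +_) δ≡0) (+-identityʳ z)))
      shear : ∀ s b → s * z′ + b ≡ δ * s + (s * z + b)
      shear s b = trans (cong (λ u → s * u + b) z′≡)
        (let open 𝔽-Solver in solve 4 (λ s z δ b → s :* (z :+ δ) :+ b := δ :* s :+ (s :* z :+ b)) refl s z δ b)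

    -- Expanding the square counts pairs of points on a common line. Since the mean of `I` over the
    -- `q ²` lines is `n c / q`, the first term is the contribution of the mean, and the second, due
    -- to `z = z′`, bounds the total variance.
    ∑I² : sum (λ s → sum (λ b → I s b ℕ.* I s b)) ≤ (n ℕ.* c) ℕ.* (n ℕ.* c) ℕ.+ q ℕ.* (n ℕ.* c)
    ∑I² = begin
      sum (λ s → sum (λ b → I s b ℕ.* I s b))
        ≡⟨ ∑.sum-cong-≗ (λ s → trans
             (∑.sum-cong-≗ λ b → sum-*-sum (λ z → α z ℕ.* κ (s * z + b)) (λ z → α z ℕ.* κ (s * z + b)))
             (sum-rotate (λ b z z′ → α z ℕ.* κ (s * z + b) ℕ.* (α z′ ℕ.* κ (s * z′ + b))))) ⟩
      sum (λ s → sum (λ z → sum (λ z′ → sum (λ b → α z ℕ.* κ (s * z + b) ℕ.* (α z′ ℕ.* κ (s * z′ + b))))))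
        ≡⟨ sum-rotate (λ s z z′ → sum (λ b → α z ℕ.* κ (s * z + b) ℕ.* (α z′ ℕ.* κ (s * z′ + b)))) ⟩
      sum (λ z → sum (λ z′ → sum (λ s → sum (λ b → α z ℕ.* κ (s * z + b) ℕ.* (α z′ ℕ.* κ (s * z′ + b))))))
        ≡⟨ sum₂-cong extract ⟩
      sum (λ z → sum (λ z′ → α z ℕ.* α z′ ℕ.* pairs z z′))
        ≤⟨ sum-mono-≤ (λ z → sum-mono-≤ λ z′ → ℕ.*-monoʳ-≤ (α z ℕ.* α z′) (pairs≤ z z′)) ⟩
      sum (λ z → sum (λ z′ → α z ℕ.* α z′ ℕ.* (c ℕ.* c ℕ.+ 𝟙 (z′ ≟ z) ℕ.* (q ℕ.* c))))
        ≡⟨ sum₂-cong (λ z z′ → let open +-*-Solver in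
             solve 5 (λ u v w i t → u :* v :* (w :+ i :* t) := u :* w :* v :+ i :* (u :* v :* t)) refl
               (α z) (α z′) (c ℕ.* c) (𝟙 (z′ ≟ z)) (q ℕ.* c)) ⟩
      sum (λ z → sum (λ z′ → α z ℕ.* (c ℕ.* c) ℕ.* α z′ ℕ.+ 𝟙 (z′ ≟ z) ℕ.* (α z ℕ.* α z′ ℕ.* (q ℕ.* c))))
        ≡⟨ ∑.sum-cong-≗ (λ z → trans
             (∑.∑-distrib-+ (λ z′ → α z ℕ.* (c ℕ.* c) ℕ.* α z′) (λ z′ → 𝟙 (z′ ≟ z) ℕ.* (α z ℕ.* α z′ ℕ.* (q ℕ.* c))))
             (cong₂ ℕ._+_ (sym (∑.*-distribˡ-sum (α z ℕ.* (c ℕ.* c)) α))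
                          (trans (sum-𝟙≟ z (λ z′ → α z ℕ.* α z′ ℕ.* (q ℕ.* c)))
                                 (cong (ℕ._* (q ℕ.* c)) (𝟙-idem (power? z)))))) ⟩
      sum (λ z → α z ℕ.* (c ℕ.* c) ℕ.* n ℕ.+ α z ℕ.* (q ℕ.* c))
        ≡⟨ ∑.sum-cong-≗ (λ z → let open +-*-Solver in
             solve 4 (λ u c n q → u :* (c :* c) :* n :+ u :* (q :* c) := u :* (c :* c :* n :+ q :* c)) refl
               (α z) c n q) ⟩
      sum (λ z → α z ℕ.* (c ℕ.* c ℕ.* n ℕ.+ q ℕ.* c))
        ≡⟨ ∑.*-distribʳ-sum (c ℕ.* c ℕ.* n ℕ.+ q ℕ.* c) α ⟨
      n ℕ.* (c ℕ.* c ℕ.* n ℕ.+ q ℕ.* c)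
        ≡⟨ (let open +-*-Solver in
             solve 3 (λ n c q → n :* (c :* c :* n :+ q :* c) := n :* c :* (n :* c) :+ q :* (n :* c)) refl n c q) ⟩
      (n ℕ.* c) ℕ.* (n ℕ.* c) ℕ.+ q ℕ.* (n ℕ.* c) ∎
      where
      open ℕ.≤-Reasoning
      extract : ∀ z z′ → sum (λ s → sum (λ b → α z ℕ.* κ (s * z + b) ℕ.* (α z′ ℕ.* κ (s * z′ + b))))
                       ≡ α z ℕ.* α z′ ℕ.* pairs z z′
      extract z z′ = trans
        (∑.sum-cong-≗ λ s → trans
          (∑.sum-cong-≗ λ b → let open +-*-Solver in
             solve 4 (λ u v x y → u :* x :* (v :* y) := u :* v :* (x :* y)) refl
               (α z) (α z′) (κ (s * z + b)) (κ (s * z′ + b)))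
          (sym (∑.*-distribˡ-sum (α z ℕ.* α z′) (λ b → κ (s * z + b) ℕ.* κ (s * z′ + b)))))
        (sym (∑.*-distribˡ-sum (α z ℕ.* α z′) (λ s → sum λ b → κ (s * z + b) ℕ.* κ (s * z′ + b))))

    am-gm-off-line : ∀ x i → 2 ℕ.* (x ℕ.* (q ℕ.* i)) ℕ.+ x ℕ.* x ℕ.* 0
                           ≤ x ℕ.* x ℕ.+ q ℕ.* q ℕ.* (i ℕ.* i)
    am-gm-off-line x i = subst₂ _≤_
      (solve 2 (λ x v → con 2 :* (x :* v) := con 2 :* (x :* v) :+ x :* x :* con 0) refl x (q ℕ.* i))
      (solve 3 (λ x q i → x :* x :+ q :* i :* (q :* i) := x :* x :+ q :* q :* (i :* i)) refl x q i)
      (am-gm x (q ℕ.* i))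
      where open +-*-Solver

    -- Chebyshev's inequality without subtraction: the square of `x − q I s b` is never negative,
    -- and it equals `x ²` when `s` and `b` are both powers, because `I s b` is then 0.
    I-am-gm : ∀ x s b → 2 ℕ.* (x ℕ.* (q ℕ.* I s b)) ℕ.+ x ℕ.* x ℕ.* (α s ℕ.* α b)
                      ≤ x ℕ.* x ℕ.+ q ℕ.* q ℕ.* (I s b ℕ.* I s b)
    I-am-gm x s b with power? s in s? | power? b in b?
    ... | yes s∈A | yes b∈A rewrite I-vanishes s∈A b∈A =
      ℕ.≤-reflexive (let open +-*-Solver in
        solve 2 (λ x q → con 2 :* (x :* (q :* con 0)) :+ x :* x :* (con 1 :* con 1)
                      := x :* x :+ q :* q :* (con 0 :* con 0)) refl x q)
    ... | yes _ | no _ = am-gm-off-line x (I s b)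
    ... | no _  | _    = am-gm-off-line x (I s b)

    sum₂-am-gm : ∀ x → 2 ℕ.* (x ℕ.* (q ℕ.* (q ℕ.* (n ℕ.* c)))) ℕ.+ x ℕ.* x ℕ.* (n ℕ.* n)
                     ≤ q ℕ.* (q ℕ.* (x ℕ.* x))
                       ℕ.+ q ℕ.* q ℕ.* ((n ℕ.* c) ℕ.* (n ℕ.* c) ℕ.+ q ℕ.* (n ℕ.* c))
    sum₂-am-gm x = begin
      2 ℕ.* (x ℕ.* (q ℕ.* (q ℕ.* (n ℕ.* c)))) ℕ.+ x ℕ.* x ℕ.* (n ℕ.* n)
        ≡⟨ cong₂ ℕ._+_ linear quadratic ⟨
      sum (λ s → sum (l s)) ℕ.+ sum (λ s → sum (r s))
        ≡⟨ sum₂-distrib-+ l r ⟨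
      sum (λ s → sum (λ b → l s b ℕ.+ r s b))
        ≤⟨ sum-mono-≤ (λ s → sum-mono-≤ (I-am-gm x s)) ⟩
      sum (λ s → sum (λ b → x ℕ.* x ℕ.+ q ℕ.* q ℕ.* (I s b ℕ.* I s b)))
        ≡⟨ sum₂-distrib-+ (λ _ _ → x ℕ.* x) (λ s b → q ℕ.* q ℕ.* (I s b ℕ.* I s b)) ⟩
      sum {q} (λ s → sum {q} (λ b → x ℕ.* x)) ℕ.+ sum (λ s → sum (λ b → q ℕ.* q ℕ.* (I s b ℕ.* I s b)))
        ≡⟨ cong₂ ℕ._+_ (trans (∑.sum-cong-≗ {q} λ s → sum-const q (x ℕ.* x)) (sum-const q (q ℕ.* (x ℕ.* x))))
                       (sym (*-distribˡ-sum₂ (q ℕ.* q) (λ s b → I s b ℕ.* I s b))) ⟩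
      q ℕ.* (q ℕ.* (x ℕ.* x)) ℕ.+ q ℕ.* q ℕ.* sum (λ s → sum (λ b → I s b ℕ.* I s b))
        ≤⟨ ℕ.+-monoʳ-≤ (q ℕ.* (q ℕ.* (x ℕ.* x))) (ℕ.*-monoʳ-≤ (q ℕ.* q) ∑I²) ⟩
      q ℕ.* (q ℕ.* (x ℕ.* x)) ℕ.+ q ℕ.* q ℕ.* ((n ℕ.* c) ℕ.* (n ℕ.* c) ℕ.+ q ℕ.* (n ℕ.* c)) ∎
      where
      open ℕ.≤-Reasoning
      l r : A → A → ℕ
      l s b = 2 ℕ.* (x ℕ.* (q ℕ.* I s b))
      r s b = x ℕ.* x ℕ.* (α s ℕ.* α b)
      linear : sum (λ s → sum (l s)) ≡ 2 ℕ.* (x ℕ.* (q ℕ.* (q ℕ.* (n ℕ.* c))))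
      linear = trans (sum₂-cong λ s b → solve 3 (λ x q i → con 2 :* (x :* (q :* i)) := con 2 :* x :* q :* i) refl x q (I s b))
        (trans (sym (*-distribˡ-sum₂ (2 ℕ.* x ℕ.* q) I))
          (trans (cong (2 ℕ.* x ℕ.* q ℕ.*_) (trans (∑.sum-cong-≗ ∑I) (sum-const q (n ℕ.* c))))
            (solve 3 (λ x q i → con 2 :* x :* q :* i := con 2 :* (x :* (q :* i))) refl x q (q ℕ.* (n ℕ.* c)))))
        where open +-*-Solver
      quadratic : sum (λ s → sum (r s)) ≡ x ℕ.* x ℕ.* (n ℕ.* n)
      quadratic = trans (sym (*-distribˡ-sum₂ (x ℕ.* x) (λ s b → α s ℕ.* α b)))
        (cong (x ℕ.* x ℕ.*_) (sym (sum-*-sum α α)))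

    m≤k⁴ : m ≤ k ℕ.* k ℕ.* (k ℕ.* k)
    m≤k⁴ = ℕ.*-cancelˡ-≤ {m} {k ℕ.* k ℕ.* (k ℕ.* k)} (q ℕ.* q ℕ.* q) (begin
      q ℕ.* q ℕ.* q ℕ.* m
        ≤⟨ ℕ.*-mono-≤ (ℕ.*-mono-≤ (ℕ.*-mono-≤ q≤kn q≤kn) q≤kn) m≤kc ⟩
      k ℕ.* n ℕ.* (k ℕ.* n) ℕ.* (k ℕ.* n) ℕ.* (k ℕ.* c)
        ≡⟨ solve 3 (λ k n c → k :* n :* (k :* n) :* (k :* n) :* (k :* c)
                           := n :* c :* (n :* n) :* (k :* k :* (k :* k))) refl k n c ⟩
      n ℕ.* c ℕ.* (n ℕ.* n) ℕ.* (k ℕ.* k ℕ.* (k ℕ.* k))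
        ≤⟨ ℕ.*-monoˡ-≤ (k ℕ.* k ℕ.* (k ℕ.* k)) cubic ⟩
      q ℕ.* q ℕ.* q ℕ.* (k ℕ.* k ℕ.* (k ℕ.* k)) ∎)
      where
      open ℕ.≤-Reasoning
      open +-*-Solver
      -- `x` is q times the mean of `I`, so that the squares in `I-am-gm` measure the variance.
      x = n ℕ.* c
      0<x : 0 < x
      0<x = ℕ.*-mono-≤ {1} (ℕ.n≢0⇒n>0 λ n≡0 → ℕ.<⇒≱ (s≤s (z≤n {m})) (subst (λ t → q ≤ t) (trans (cong (k ℕ.*_) n≡0) (ℕ.*-zeroʳ k)) q≤kn))
                           (ℕ.n≢0⇒n>0 λ c≡0 → ℕ.<⇒≱ 0<m (subst (λ t → m ≤ t) (trans (cong (k ℕ.*_) c≡0) (ℕ.*-zeroʳ k)) m≤kc))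
      -- For this `x` the term `2 q ² x ²` occurs on both sides and cancels, leaving
      -- `x ² n ² ≤ q ³ x`.
      cubic : x ℕ.* (n ℕ.* n) ≤ q ℕ.* q ℕ.* q
      cubic = ℕ.*-cancelˡ-≤ x {{ℕ.>-nonZero 0<x}}
        (ℕ.+-cancelˡ-≤ (2 ℕ.* (x ℕ.* (q ℕ.* (q ℕ.* x)))) _ _
          (subst₂ _≤_
            (solve 4 (λ x q n c → con 2 :* (x :* (q :* (q :* x))) :+ x :* x :* (n :* n)
                               := con 2 :* (x :* (q :* (q :* x))) :+ x :* (x :* (n :* n))) refl x q n c)
            (solve 2 (λ x q → q :* (q :* (x :* x)) :+ q :* q :* (x :* x :+ q :* x)
                           := con 2 :* (x :* (q :* (q :* x))) :+ x :* (q :* q :* q)) refl x q)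
            (sum₂-am-gm x)))

  -- The incidence argument only refutes `¬ Sum k 2 a`; a finite search turns this into a
  -- representation.
  Sum₂? : ∀ k a → Dec (Sum k 2 a)
  Sum₂? k a = Fin.any? λ x → Fin.any? λ b → Sum₁? b ×-dec (a ≟ x ^ k + b)
    where
    Sum₁? : ∀ b → Dec (Sum k 1 b)
    Sum₁? b = Fin.any? λ y → Fin.any? λ z → (z ≟ 0#) ×-dec (b ≟ y ^ k + z)

  large-covers : ∀ d → suc d ℕ.* suc d ℕ.* (suc d ℕ.* suc d) < m → Covers (suc d) 2
  large-covers d k⁴<m a with Sum₂? (suc d) a | a ≟ 0#
  ... | yes a∈S₂ | _        = a∈S₂
  ... | no a∉S₂  | yes refl = Sum-0 {d} 2
  ... | no a∉S₂  | no a≢0   =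
    ⊥-elim (ℕ.<⇒≱ k⁴<m (Incidence.m≤k⁴ {d} (ℕ.≤-<-trans z≤n k⁴<m) a≢0 a∉S₂))

-- Classes modulo k-th powers

module Classes {m} (𝔽 : FiniteField m) {d e : ℕ} (de≡m : suc d ℕ.* suc e ≡ m) where
  open FieldTheory 𝔽
  open PowerSums 𝔽
  open ≡-Reasoning
  private
    k : ℕ
    k = suc d

  class : A → A
  class a = a ^ suc e

  class-* : ∀ a b → class (a * b) ≡ class a * class b
  class-* a b = ^-distrib-* a b (suc e)

  class-power : ∀ {x} → x ≢ 0# → class (x ^ k) ≡ 1#
  class-power {x} x≢0 =
    trans (^-assocʳ x k (suc e)) (trans (cong (x ^_) de≡m) (fermat x≢0))

  class-power-* : ∀ {x} → x ≢ 0# → ∀ a → class (x ^ k * a) ≡ class a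
  class-power-* {x} x≢0 a = begin
    class (x ^ k * a)         ≡⟨ class-* (x ^ k) a ⟩
    class (x ^ k) * class a   ≡⟨ cong (_* class a) (class-power x≢0) ⟩
    1# * class a              ≡⟨ *-identityˡ _ ⟩
    class a                   ∎

  abstract
    -- The quotient of `a` by `r` lies in the class of 1, hence is a power by `power-residue`.
    same-class : ∀ {a r} → r ≢ 0# → class a ≡ class r → ∃ λ x → a ≡ x ^ k * r
    same-class {a} {r} r≢0 a~r with i , ri≡1 ← inverse r r≢0
      with x , ai≡ ← power-residue {d} {e} {a * i} de≡m (begin
        class (a * i)         ≡⟨ class-* a i ⟩
        class a * class i     ≡⟨ cong (_* class i) a~r ⟩
        class r * class i     ≡⟨ class-* r i ⟨
        class (r * i)         ≡⟨ cong class ri≡1 ⟩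
        class 1#              ≡⟨ 1^ (suc e) ⟩
        1#                    ∎)
      = x , (begin
        a             ≡⟨ *-identityʳ a ⟨
        a * 1#        ≡⟨ cong (a *_) (trans (*-comm i r) ri≡1) ⟨
        a * (i * r)   ≡⟨ *-assoc a i r ⟨
        a * i * r     ≡⟨ cong (_* r) ai≡ ⟩
        x ^ k * r     ∎)

  class-unity : ∀ {a} → a ≢ 0# → class a ^ k ≡ 1#
  class-unity {a} a≢0 = trans (^-comm a (suc e) k) (class-power a≢0)

  Reach : ℕ → A → Set
  Reach n v = ∀ a → class a ≡ v → Sum k n a

  reach-one : Reach 1 1#
  reach-one a a~1 with x , a≡ ← power-residue {d} {e} {a} de≡m a~1 =
    x , 0# , refl , trans a≡ (sym (+-identityʳ (x ^ k)))

  -- If `a` is `x ^ k` times `1# + u * y ^ k`, it splits into the power `x ^ k` and a summand that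
  -- lies in the class of `u` or vanishes.
  reach-suc : ∀ {n} u y → Reach n (class u) → Reach (suc n) (class (1# + u * y ^ k))
  reach-suc {n} u y reach a a~r with 1# + u * y ^ k ≟ 0#
  -- Class 0 contains only `a = 0#`, which is a sum of any number of powers.
  ... | yes r≡0 = Sum-≡0 (suc n) (decidable-stable (a ≟ 0#) λ a≢0 →
    ^-nonZero (suc e) a≢0 (trans a~r (power-≡0 e r≡0)))
  ... | no r≢0 with x , a≡ ← same-class {a} {1# + u * y ^ k} r≢0 a~r =
    x , x ^ k * (u * y ^ k) , summand , (begin
      a                                  ≡⟨ a≡ ⟩
      x ^ k * (1# + u * y ^ k)           ≡⟨ distribˡ (x ^ k) 1# (u * y ^ k) ⟩
      x ^ k * 1# + x ^ k * (u * y ^ k)   ≡⟨ cong (_+ x ^ k * (u * y ^ k)) (*-identityʳ (x ^ k)) ⟩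
      x ^ k + x ^ k * (u * y ^ k)        ∎)
    where
    summand : Sum k n (x ^ k * (u * y ^ k))
    summand with y ≟ 0# | x ≟ 0#
    ... | yes y≡0 | _       = Sum-≡0 n (trans (cong (x ^ k *_) (trans (cong (u *_) (power-≡0 d y≡0)) (zeroʳ u))) (zeroʳ (x ^ k)))
    ... | no _    | yes x≡0 = Sum-≡0 n (trans (cong (_* (u * y ^ k)) (power-≡0 d x≡0)) (zeroˡ (u * y ^ k)))
    ... | no y≢0  | no x≢0  = reach _ (trans (class-power-* x≢0 (u * y ^ k))
      (trans (cong class (*-comm u (y ^ k))) (class-power-* y≢0 u)))

  reach-covers : ∀ {w n} → HasExactOrder w k → (∀ i → i < k → Reach n (w ^ i)) → Covers k n
  reach-covers {n = n} exact reach a with a ≟ 0#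
  ... | yes refl = Sum-0 n
  ... | no a≢0 with i , i<k , a~ ← unity-root-power {n = d} exact (class-unity a≢0) = reach i i<k a a~

  -- 0 is set apart: it is always a sum of powers but lies in none of the cosets.
  Inside : List A → A → Set
  Inside us a = a ≡ 0# ⊎ Any (λ u → class a ≡ class u) us

  Inside-power-* : ∀ {us x a} → x ≢ 0# → Inside us a → Inside us (x ^ k * a)
  Inside-power-* x≢0 (inj₁ refl) = inj₁ (zeroʳ _)
  Inside-power-* x≢0 (inj₂ a~u)  = inj₂ (Any.map (trans (class-power-* x≢0 _)) a~u)

  Bounded : ℕ → List A → Set
  Bounded n us = ∀ a → Sum k n a → Inside us a

  bounded-one : Bounded 1 (1# ∷ [])
  bounded-one a (x , b , refl , a≡) with x ≟ 0#
  ... | yes refl = inj₁ (trans a≡ (trans (+-identityʳ _) (0^ d)))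
  ... | no x≢0   = inj₂ (here (trans (cong class (trans a≡ (+-identityʳ _)))
                          (trans (class-power x≢0) (sym (1^ (suc e))))))

  -- Dividing by a nonzero first summand `x ^ k` leaves `1# + b′`, where `b′` is again a sum of n
  -- powers. If `b′` is nonzero, it is some listed `u` times a nonzero k-th power, and those are
  -- exactly the powers of `h`. The cases `b′ ≡ 0#` and `x ≡ 0#` are met by `Inside us′ 1#` and by
  -- the inclusion of `us` in `us′`.
  bounded-suc : ∀ {n h us us′} → HasExactOrder h (suc e) → Bounded n us →
                (∀ {a} → Inside us a → Inside us′ a) → Inside us′ 1# →
                All (λ u → ∀ i → i < suc e → Inside us′ (1# + u * h ^ i)) us →
                Bounded (suc n) us′
  bounded-suc {n} {h} {us} {us′} exact bounded us⊆us′ one step a (x , b , b∈Sₙ , a≡) with x ≟ 0#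
  ... | yes refl = subst (Inside us′) (sym (trans a≡ (trans (cong (_+ b) (0^ d)) (+-identityˡ b))))
                     (us⊆us′ (bounded b b∈Sₙ))
  ... | no x≢0 with i , xi≡1 ← inverse x x≢0 = subst (Inside us′) (sym a≡′)
                     (Inside-power-* x≢0 (inside (Inside-power-* i≢0 (bounded b b∈Sₙ))))
    where
    i≢0 : i ≢ 0#
    i≢0 refl = 0≢1 (trans (sym (zeroʳ x)) xi≡1)
    b′ : A
    b′ = i ^ k * b
    a≡′ : a ≡ x ^ k * (1# + b′)
    a≡′ = begin
      a                                ≡⟨ a≡ ⟩
      x ^ k + b                        ≡⟨ cong₂ _+_ (*-identityʳ _) (*-identityˡ b) ⟨
      x ^ k * 1# + 1# * b              ≡⟨ cong (λ t → x ^ k * 1# + t * b) (1^ k) ⟨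
      x ^ k * 1# + 1# ^ k * b          ≡⟨ cong (λ t → x ^ k * 1# + t ^ k * b) xi≡1 ⟨
      x ^ k * 1# + (x * i) ^ k * b     ≡⟨ cong (λ t → x ^ k * 1# + t * b) (^-distrib-* x i k) ⟩
      x ^ k * 1# + x ^ k * i ^ k * b   ≡⟨ cong (x ^ k * 1# +_) (*-assoc _ _ _) ⟩
      x ^ k * 1# + x ^ k * b′          ≡⟨ distribˡ _ _ _ ⟨
      x ^ k * (1# + b′)                ∎
    inside-class : ∀ {u} → b′ ≢ 0# → class b′ ≡ class u →
                   (∀ i → i < suc e → Inside us′ (1# + u * h ^ i)) → Inside us′ (1# + b′)
    inside-class {u} b′≢0 b′~u step-u
      with y , b′≡ ← same-class {b′} {u} (λ u≡0 → ^-nonZero (suc e) b′≢0 (trans b′~u (power-≡0 e u≡0))) b′~u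
      with t , t<e , y^k≡ ← unity-root-power {n = e} exact (class-power {y} λ y≡0 →
             b′≢0 (trans b′≡ (trans (cong (λ t → t ^ k * u) y≡0) (trans (cong (_* u) (0^ d)) (zeroˡ u)))))
      = subst (λ t → Inside us′ (1# + t))
          (trans (cong (u *_) (sym y^k≡)) (trans (*-comm u _) (sym b′≡))) (step-u t t<e)
    inside : Inside us b′ → Inside us′ (1# + b′)
    inside b′∈us with b′ ≟ 0# | b′∈us
    ... | yes b′≡0 | _          = subst (Inside us′) (sym (trans (cong (1# +_) b′≡0) (+-identityʳ 1#))) one
    ... | no b′≢0  | inj₁ b′≡0  = ⊥-elim (b′≢0 b′≡0)
    ... | no b′≢0  | inj₂ b′~us =
      All.lookupWith (λ step-u b′~u → inside-class b′≢0 b′~u step-u) step b′~us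

  -- The powers of `g` run through k distinct classes; by pigeonhole two of them would share an
  -- entry of `us`.
  bounded-¬covers : ∀ {g n us} → HasExactOrder (class g) k → length us < k → Bounded n us → ¬ Covers k n
  bounded-¬covers {g} {n} {us} exact short bounded covers =
    let i , j , i<j , eq = Fin.pigeonhole short position in
    powers-≢ exact i<j (Fin.toℕ<n j) (trans (class-gⁱ i)
      (trans (cong (λ p → class (lookup us p)) eq) (sym (class-gⁱ j))))
    where
    g≢0 : g ≢ 0#
    g≢0 refl = root-nonZero d (proj₁ exact) (0^ e)
    found : ∀ (i : Fin k) → Any (λ u → class (g ^ toℕ i) ≡ class u) us
    found i with bounded (g ^ toℕ i) (covers _)
    ... | inj₁ gⁱ≡0 = ⊥-elim (^-nonZero (toℕ i) g≢0 gⁱ≡0)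
    ... | inj₂ gⁱ~u = gⁱ~u
    position : Fin k → Fin (length us)
    position i = Any.index (found i)
    class-gⁱ : ∀ i → class g ^ toℕ i ≡ class (lookup us (position i))
    class-gⁱ i = trans (^-comm g (suc e) (toℕ i)) (Any.lookup-index (found i))

-- Certified computations

-- Lowest bit first. Every expansion that is used gets compared with its number through `fromBits`;
-- a fuel of 20 is ample for exponents up to `19 ⁴`.
bits : ℕ → ℕ → List Bool
bits zero       n = []
bits (suc fuel) 0 = []
bits (suc fuel) n = (1 ≡ᵇ n % 2) ∷ bits fuel (n / 2)

fromBits : List Bool → ℕ
fromBits []       = 0
fromBits (b ∷ bs) = (if b then 1 else 0) ℕ.+ 2 ℕ.* fromBits bs

anyOf allOf : {A : Set} → (A → Bool) → List A → Bool
anyOf p []       = false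
anyOf p (x ∷ xs) = p x ∨ anyOf p xs
allOf p []       = true
allOf p (x ∷ xs) = p x ∧ allOf p xs

-- Operations without laws; `Represents` ties them to a field. Negative answers of `_==_` and
-- `apart₁` assert nothing, so a missed equality can only lengthen a list of classes.
record Arithmetic : Set₁ where
  infixl 7 _⊗_
  infix 4 _==_
  field
    M        : Set
    zeroᴹ one : M
    inc      : M → M
    _⊗_      : M → M → M
    _==_     : M → M → Bool
    apart₁   : M → Bool

  power : M → List Bool → M
  power x []           = one
  power x (true ∷ bs)  = x ⊗ power (x ⊗ x) bs
  power x (false ∷ bs) = power (x ⊗ x) bs

  powersFrom : M → M → ℕ → List M
  powersFrom w x zero    = []
  powersFrom w x (suc n) = x ∷ powersFrom w (w ⊗ x) n

  -- Called with `x = w`: the powers of `w` with exponents 1 to n are apart from 1 and the next one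
  -- is 1, so the order is `suc n`.
  orderFrom : M → M → ℕ → Bool
  orderFrom w x zero    = x == one
  orderFrom w x (suc n) = apart₁ x ∧ orderFrom w (w ⊗ x) n

  candidates : List M → List M → List M
  candidates hs us = concatMap (λ u → map (λ h → inc (u ⊗ h)) hs) us

module Check (R : Arithmetic) (d e : ℕ) where
  open Arithmetic R

  dBits eBits : List Bool
  dBits = bits 20 (suc d)
  eBits = bits 20 (suc e)

  dth eth : M → M
  dth x = power x dBits
  eth x = power x eBits

  bitsOK : Bool
  bitsOK = (fromBits dBits ≡ᵇ suc d) ∧ (fromBits eBits ≡ᵇ suc e)

  -- Each entry stores a representative with its class. A representative of class 0 is dropped,
  -- since `Inside` always admits 0.
  insert : M → List (M × M) → List (M × M)
  insert r us = insertClass (eth r)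
    where
    insertClass : M → List (M × M)
    insertClass v = if (v == zeroᴹ) ∨ anyOf (λ u → v == proj₂ u) us then us else (r , v) ∷ us

  -- Index n belongs to sums of `suc n` powers: `zero` starts with the class of 1, that of a single
  -- nonzero power.
  level : List M → ℕ → List (M × M)
  level hs zero    = (one , one) ∷ []
  level hs (suc n) = close (level hs n)
    where
    close : List (M × M) → List (M × M)
    close us = foldr insert us (candidates hs (map proj₁ us))

  allIn : List M → List M → Bool
  allIn ws vs = allOf (λ w → anyOf (λ v → v == w) vs) ws

  covers : M → List M → List M → Bool
  covers w hs us = allIn (powersFrom w one (suc d)) (map eth (us ++ candidates hs us))

  -- Verdict 2 claims only an upper bound, so `hs` may be any sample of d-th powers and only the
  -- class of `g` has its order tested.
  twoCheck : List M → List M → Bool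
  twoCheck gs hs =
    anyOf (λ g → orderFrom (eth g) (eth g) d ∧ covers (eth g) hs (one ∷ [])) gs

  -- For the verdict `j = n + 2`, `level hs n` belongs to sums of `j − 1` powers: fewer than `suc d`
  -- classes refute `j − 1`, and one further step must cover. The case `4 < n` is the verdict 7,
  -- without an upper bound. The order of `dth g` ensures that `hs` exhausts the nonzero d-th
  -- powers.
  fullCheck : ℕ → List M → Bool
  fullCheck n gs = anyOf (λ g → orderFrom (eth g) (eth g) d ∧ orderFrom (dth g) (dth g) e ∧
    fullCheckWith (eth g) (powersFrom (dth g) one (suc e))) gs
    where
    fullCheckLevel : M → List M → List M → Bool
    fullCheckLevel w hs us = (length us <ᵇ suc d) ∧ ((4 <ᵇ n) ∨ covers w hs us)
    fullCheckWith : M → List M → Bool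
    fullCheckWith w hs = fullCheckLevel w hs (map proj₁ (level hs n))

  -- The first argument n stands for the verdict n + 2.
  check : ℕ → List M → List M → Bool
  check zero    gs hs = bitsOK ∧ twoCheck gs hs
  check (suc n) gs hs = bitsOK ∧ fullCheck (suc n) gs

  generatorCheck : ℕ → ℕ → M → Bool
  generatorCheck l n g = check n (g ∷ []) (powersFrom (dth g) one l)

primeArithmetic : ℕ → Arithmetic
primeArithmetic p-1 = record
  { M      = ℕ
  ; zeroᴹ  = 0
  ; one    = 1
  ; inc    = λ x → suc x % suc p-1
  ; _⊗_    = λ x y → (x ℕ.* y) % suc p-1
  ; _==_   = _≡ᵇ_
  ; apart₁ = λ x → not (x ≡ᵇ 1) ∧ (x <ᵇ suc p-1)
  }

module Extension (p-1 : ℕ) {k : ℕ} (f : Vec ℕ (suc k)) where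
  M : Set
  M = Vec ℕ (suc k)

  const+ : ∀ {n} → ℕ → Vec ℕ (suc n) → Vec ℕ (suc n)
  const+ c (x ∷ [])         = (c ℕ.+ x) % suc p-1 ∷ []
  const+ c (x ∷ xs@(_ ∷ _)) = x ∷ const+ c xs

  constant : ∀ {n} → ℕ → Vec ℕ n
  constant {zero}        c = []
  constant {suc zero}    c = c ∷ []
  constant {suc (suc n)} c = 0 ∷ constant c

  -- a f + u v + x r, for coefficients listed from the leading one down
  combine : ∀ {n} → ℕ → Vec ℕ (suc n) → ℕ → Vec ℕ (suc n) → Vec ℕ n → Vec ℕ (suc n)
  combine a (f ∷ [])         u (v ∷ [])         []       = (a ℕ.* f ℕ.+ u ℕ.* v) % suc p-1 ∷ []
  combine a (f ∷ fs@(_ ∷ _)) u (v ∷ vs@(_ ∷ _)) (r ∷ rs) =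
    (a ℕ.* f ℕ.+ u ℕ.* v ℕ.+ r) % suc p-1 ∷ combine a fs u vs rs

  -- Multiplication by x, where the leading coefficient `r` overflows into `r f`; the middle product
  -- of `combine` is filled with `0 · f`.
  shift : M → M
  shift (r ∷ rs) = combine r f 0 f rs

  -- Horner's scheme in the first factor, replacing the overflowing power of x by `f` at each step.
  mulAcc : ∀ {n} → Vec ℕ n → M → M → M
  mulAcc []       v acc      = acc
  mulAcc (u ∷ us) v (r ∷ rs) = mulAcc us v (combine r f u v rs)

  mul : M → M → M
  mul u v = mulAcc u v (constant 0)

  eqVec : ∀ {n} → Vec ℕ n → Vec ℕ n → Bool
  eqVec []       []       = true
  eqVec (v ∷ vs) (w ∷ ws) = (v ≡ᵇ w) ∧ eqVec vs ws

  shifts : ℕ → M → M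
  shifts zero    v = v
  shifts (suc n) v = shift (shifts n v)

  -- Since `f` represents `x ^ suc k`, the test says that `x ^ (s + suc k)` is 1, that is,
  -- `x ^ suc k − f` divides `x ^ (s + suc k) − 1`.
  rootCheck : ℕ → Bool
  rootCheck s = eqVec (shifts s f) (constant 1)

  ringArithmetic : (M → Bool) → Arithmetic
  ringArithmetic apart = record
    { M      = M
    ; zeroᴹ  = constant 0
    ; one    = constant 1
    ; inc    = const+ 1
    ; _⊗_    = mul
    ; _==_   = eqVec
    ; apart₁ = apart
    }

  -- Different vectors might have the same image in the field. An m-th power equal to 1 certifies
  -- that the image is not 0.
  isUnit : ℕ → M → Bool
  isUnit m x = isUnitBits (bits 20 m)
    where
    isUnitBits : List Bool → Bool
    isUnitBits bs = (fromBits bs ≡ᵇ m) ∧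
                    eqVec (Arithmetic.power (ringArithmetic (λ _ → false)) x bs) (constant 1)

  -- Modulo p, `const+ p-1 x` is `x − 1`; its being a unit separates `x` from 1.
  extensionArithmetic : ℕ → Arithmetic
  extensionArithmetic m = ringArithmetic (λ x → isUnit m (const+ p-1 x))

range : ℕ → ℕ → List ℕ
range i zero    = []
range i (suc n) = i ∷ range (suc i) n

-- A suitable `g` is sought among 1 to 100, and the sample consists of the d-th powers of 1 to 600.
-- That these ranges are wide enough is confirmed by `primes-verified`.
primeCheck : ℕ → ℕ → ℕ → Bool
primeCheck d e j = check j (range 1 100) (map dth (range 1 600))
  where open Check (primeArithmetic (suc d ℕ.* suc e)) d e

-- Soundness of the checks

∧-sound : ∀ {a b} → T (a ∧ b) → T a × T b
∧-sound {true} b = tt , b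

∨-sound : ∀ {a b} → T (a ∨ b) → T a ⊎ T b
∨-sound {true}  a = inj₁ a
∨-sound {false} b = inj₂ b

allOf-sound : ∀ {A : Set} (p : A → Bool) xs → T (allOf p xs) → All (T ∘ p) xs
allOf-sound p []       _  = []
allOf-sound p (x ∷ xs) ok = let px , pxs = ∧-sound ok in px ∷ allOf-sound p xs pxs

anyOf-sound : ∀ {A : Set} (p : A → Bool) xs → T (anyOf p xs) → Any (T ∘ p) xs
anyOf-sound p (x ∷ xs) ok = [ here , there ∘ anyOf-sound p xs ]′ (∨-sound ok)

Any-mapWith : ∀ {A : Set} {P Q R : A → Set} → (∀ {x} → P x → Q x → R x) →
              ∀ {xs} → All P xs → Any Q xs → Any R xs
Any-mapWith f (px ∷ _)  (here qx)  = here (f px qx)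
Any-mapWith f (_ ∷ pxs) (there qs) = there (Any-mapWith f pxs qs)

-- A homomorphism for exactly the operations of the checks: addition enters only as `1# + _`, and
-- only positive answers of the two tests carry over.
record Represents (R : Arithmetic) {m} (𝔽 : FiniteField m) : Set where
  open Arithmetic R
  open FieldTheory 𝔽
  field
    ⟦_⟧         : M → A
    ⟦zero⟧       : ⟦ zeroᴹ ⟧ ≡ 0#
    ⟦one⟧        : ⟦ one ⟧ ≡ 1#
    ⟦inc⟧        : ∀ x → ⟦ inc x ⟧ ≡ 1# + ⟦ x ⟧
    ⟦⊗⟧          : ∀ x y → ⟦ x ⊗ y ⟧ ≡ ⟦ x ⟧ * ⟦ y ⟧
    ==-sound     : ∀ x y → T (x == y) → ⟦ x ⟧ ≡ ⟦ y ⟧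
    apart₁-sound : ∀ x → T (apart₁ x) → ⟦ x ⟧ ≢ 1#

module ArithmeticSoundness {R : Arithmetic} {m} {𝔽 : FiniteField m} (rep : Represents R 𝔽) where
  open Arithmetic R
  open FieldTheory 𝔽
  open Represents rep

  ⟦power⟧ : ∀ x bs → ⟦ power x bs ⟧ ≡ ⟦ x ⟧ ^ fromBits bs
  ⟦power⟧ x []       = ⟦one⟧
  ⟦power⟧ x (b ∷ bs) with square ← trans (⟦power⟧ (x ⊗ x) bs) (trans
      (cong (_^ fromBits bs) (trans (⟦⊗⟧ x x) (cong (⟦ x ⟧ *_) (sym (*-identityʳ ⟦ x ⟧)))))
      (^-assocʳ ⟦ x ⟧ 2 (fromBits bs))) | b
  ... | true  = trans (⟦⊗⟧ x _) (cong (⟦ x ⟧ *_) square)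
  ... | false = square

  ⟦power-bits⟧ : ∀ bs n → T (fromBits bs ≡ᵇ n) → ∀ x → ⟦ power x bs ⟧ ≡ ⟦ x ⟧ ^ n
  ⟦power-bits⟧ bs n ok x = trans (⟦power⟧ x bs) (cong (⟦ x ⟧ ^_) (ℕ.≡ᵇ⇒≡ (fromBits bs) n ok))

  private
    next-power : ∀ w x i → ⟦ w ⟧ ^ i * ⟦ w ⊗ x ⟧ ≡ ⟦ w ⟧ ^ suc i * ⟦ x ⟧
    next-power w x i = trans (cong (⟦ w ⟧ ^ i *_) (⟦⊗⟧ w x))
      (solve 3 (λ p w x → p :* (w :* x) := w :* p :* x) refl (⟦ w ⟧ ^ i) ⟦ w ⟧ ⟦ x ⟧)
      where open 𝔽-Solver using (solve; _:=_; _:*_)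

  powersFrom-∈ : ∀ w x {n i} → i < n → ∃ λ v → v ∈ powersFrom w x n × ⟦ v ⟧ ≡ ⟦ w ⟧ ^ i * ⟦ x ⟧
  powersFrom-∈ w x {suc n} {zero}  _         = x , here refl , sym (*-identityˡ _)
  powersFrom-∈ w x {suc n} {suc i} (s≤s i<n) with v , v∈ , eq ← powersFrom-∈ w (w ⊗ x) i<n =
    v , there v∈ , trans eq (next-power w x i)

  powersFrom-All : ∀ w x n → All (λ v → ∃ λ i → ⟦ v ⟧ ≡ ⟦ w ⟧ ^ i * ⟦ x ⟧) (powersFrom w x n)
  powersFrom-All w x zero    = []
  powersFrom-All w x (suc n) = (0 , sym (*-identityˡ _)) ∷
    All.map (λ (i , eq) → suc i , trans eq (next-power w x i)) (powersFrom-All w (w ⊗ x) n)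

  orderFrom-sound : ∀ w x {s} n → T (orderFrom w x n) → ⟦ x ⟧ ≡ ⟦ w ⟧ ^ s →
                    ⟦ w ⟧ ^ (n ℕ.+ s) ≡ 1# × (∀ i → s ≤ i → i < n ℕ.+ s → ⟦ w ⟧ ^ i ≢ 1#)
  orderFrom-sound w x zero ok x≡ =
    trans (sym x≡) (trans (==-sound x one ok) ⟦one⟧) , λ i s≤i i<s → ⊥-elim (ℕ.<⇒≱ i<s s≤i)
  orderFrom-sound w x {s} (suc n) ok x≡
    with apart , ok′ ← ∧-sound ok
    with unity , minimal ← orderFrom-sound w (w ⊗ x) n ok′ (trans (⟦⊗⟧ w x) (cong (⟦ w ⟧ *_) x≡)) =
    trans (cong (⟦ w ⟧ ^_) (sym (ℕ.+-suc n s))) unity , λ i s≤i i<n+s →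
      [ (λ s<i → minimal i s<i (ℕ.≤-trans i<n+s (ℕ.≤-reflexive (sym (ℕ.+-suc n s)))))
      , (λ { refl → apart₁-sound x apart ∘ trans x≡ })
      ]′ (ℕ.m≤n⇒m<n∨m≡n s≤i)

  exact-order : ∀ w n → T (orderFrom w w n) → HasExactOrder ⟦ w ⟧ (suc n)
  exact-order w n ok with unity , minimal ← orderFrom-sound w w {1} n ok (sym (*-identityʳ _)) =
    trans (cong (⟦ w ⟧ ^_) (sym n+1)) unity ,
    λ i 0<i i<n → minimal i 0<i (ℕ.≤-trans i<n (ℕ.≤-reflexive (sym n+1)))
    where
    n+1 : n ℕ.+ 1 ≡ suc n
    n+1 = ℕ.+-comm n 1

  ⟦candidate⟧ : ∀ u h → ⟦ inc (u ⊗ h) ⟧ ≡ 1# + ⟦ u ⟧ * ⟦ h ⟧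
  ⟦candidate⟧ u h = trans (⟦inc⟧ (u ⊗ h)) (cong (1# +_) (⟦⊗⟧ u h))

  candidates-∈ : ∀ {us hs u h} → u ∈ us → h ∈ hs → inc (u ⊗ h) ∈ candidates hs us
  candidates-∈ {us} {hs} u∈us h∈hs = ∈-concatMap⁺ _ (Any.map (λ { refl → ∈-map⁺ _ h∈hs }) u∈us)

  candidates-All : ∀ {P : M → Set} {us hs} → All (λ u → All (λ h → P (inc (u ⊗ h))) hs) us →
                   All P (candidates hs us)
  candidates-All ps = All.concat⁺ (All.map⁺ (All.map All.map⁺ ps))

-- γ = j if 3 ≤ j ≤ 6, γ ≤ 2 if j = 2, and γ > 6 or undefined if j = 7.
Verdict : ∀ {m} → FiniteField m → ℕ → ℕ → Set
Verdict 𝔽 d j = (j ≤ 6 → Covers (suc d) j) × (3 ≤ j → ¬ Covers (suc d) (ℕ.pred j))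
  where open PowerSums 𝔽

module CheckSoundness {R : Arithmetic} {m} {𝔽 : FiniteField m} (rep : Represents R 𝔽)
                      {d e} (de≡m : suc d ℕ.* suc e ≡ m) where
  open Arithmetic R
  open FieldTheory 𝔽
  open PowerSums 𝔽
  open Classes 𝔽 {d} {e} de≡m
  open Represents rep
  open ArithmeticSoundness rep
  open Check R d e

  reps : List (M × M) → List A
  reps = map (⟦_⟧ ∘ proj₁)

  -- `reached` serves the upper bound and `bounded` the lower one; `one-in` feeds the case of
  -- `bounded-suc` in which the other summands add up to 0.
  record LevelOK (n : ℕ) (us : List (M × M)) : Set where
    field
      classes : All (λ u → ⟦ proj₂ u ⟧ ≡ class ⟦ proj₁ u ⟧) us
      reached : All (λ u → Reach n (class ⟦ proj₁ u ⟧)) us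
      bounded : Bounded n (reps us)
      one-in  : Inside (reps us) 1#

  IsPower : M → Set
  IsPower h = ∃ λ y → ⟦ h ⟧ ≡ y ^ suc d

  private
    ⟦hⁱ⟧ : ∀ {h v} i → ⟦ v ⟧ ≡ ⟦ h ⟧ ^ i * ⟦ one ⟧ → ⟦ v ⟧ ≡ ⟦ h ⟧ ^ i
    ⟦hⁱ⟧ {h} i eq = trans eq (trans (cong (⟦ h ⟧ ^ i *_) ⟦one⟧) (*-identityʳ _))

  powersFrom-IsPower : ∀ h → IsPower h → ∀ n → All IsPower (powersFrom h one n)
  powersFrom-IsPower h (y , h≡) n = All.map (λ (i , eq) →
      y ^ i , trans (⟦hⁱ⟧ {h} i eq) (trans (cong (_^ i) h≡) (^-comm y (suc d) i)))
    (powersFrom-All h one n)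

  module _ (bits-ok : T bitsOK) where
    ⟦dth⟧ : ∀ x → ⟦ dth x ⟧ ≡ ⟦ x ⟧ ^ suc d
    ⟦dth⟧ = ⟦power-bits⟧ dBits (suc d) (proj₁ (∧-sound {fromBits dBits ≡ᵇ suc d} bits-ok))

    ⟦eth⟧ : ∀ x → ⟦ eth x ⟧ ≡ class ⟦ x ⟧
    ⟦eth⟧ = ⟦power-bits⟧ eBits (suc e) (proj₂ (∧-sound {fromBits dBits ≡ᵇ suc d} bits-ok))

    insert-sound : ∀ {n} r {us} → Reach n (class ⟦ r ⟧) →
                   All (λ u → ⟦ proj₂ u ⟧ ≡ class ⟦ proj₁ u ⟧) us →
                   All (λ u → Reach n (class ⟦ proj₁ u ⟧)) us →
                   let us′ = insert r us in
                   All (λ u → ⟦ proj₂ u ⟧ ≡ class ⟦ proj₁ u ⟧) us′ ×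
                   All (λ u → Reach n (class ⟦ proj₁ u ⟧)) us′ ×
                   (∀ {a} → Inside (reps us) a → Inside (reps us′) a) ×
                   Inside (reps us′) ⟦ r ⟧
    insert-sound r {us} reach classes reached
      with (eth r == zeroᴹ) ∨ anyOf (λ u → eth r == proj₂ u) us in present
    ... | false = ⟦eth⟧ r ∷ classes , reach ∷ reached ,
                  [ inj₁ , inj₂ ∘ there ]′ , inj₂ (here refl)
    ... | true = classes , reached , id , [ vanishing , known ]′ (∨-sound (subst T (sym present) tt))
      where
      vanishing : T (eth r == zeroᴹ) → Inside (reps us) ⟦ r ⟧
      vanishing r~0 = inj₁ (decidable-stable (⟦ r ⟧ ≟ 0#) λ r≢0 → ^-nonZero (suc e) r≢0
        (trans (sym (⟦eth⟧ r)) (trans (==-sound (eth r) zeroᴹ r~0) ⟦zero⟧)))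
      known : T (anyOf (λ u → eth r == proj₂ u) us) → Inside (reps us) ⟦ r ⟧
      known r~us = inj₂ (Any.map⁺ (Any-mapWith
        (λ class≡ r~u → trans (sym (⟦eth⟧ r)) (trans (==-sound (eth r) _ r~u) class≡))
        classes (anyOf-sound _ us r~us)))

    insertAll-sound : ∀ {n us} cs → All (λ r → Reach n (class ⟦ r ⟧)) cs →
                      All (λ u → ⟦ proj₂ u ⟧ ≡ class ⟦ proj₁ u ⟧) us →
                      All (λ u → Reach n (class ⟦ proj₁ u ⟧)) us →
                      let us′ = foldr insert us cs in
                      All (λ u → ⟦ proj₂ u ⟧ ≡ class ⟦ proj₁ u ⟧) us′ ×
                      All (λ u → Reach n (class ⟦ proj₁ u ⟧)) us′ ×
                      (∀ {a} → Inside (reps us) a → Inside (reps us′) a) ×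
                      All (λ r → Inside (reps us′) ⟦ r ⟧) cs
    insertAll-sound []       []                classes reached = classes , reached , id , []
    insertAll-sound (r ∷ cs) (reach ∷ reaches) classes reached =
      let classes₁ , reached₁ , grow₁ , inside₁ = insertAll-sound cs reaches classes reached
          classes₂ , reached₂ , grow₂ , inside₂ = insert-sound r reach classes₁ reached₁
      in classes₂ , reached₂ , grow₂ ∘ grow₁ , inside₂ ∷ All.map grow₂ inside₁

    candidates-reach : ∀ {n us hs} → All (λ u → Reach n (class ⟦ u ⟧)) us → All IsPower hs →
                       All (λ r → Reach (suc n) (class ⟦ r ⟧)) (candidates hs us)
    candidates-reach {n} {us} {hs} reached powers = candidates-All (All.map (λ {u} reach →
      All.map (λ {h} (y , h≡) → subst (Reach (suc n) ∘ class)
        (sym (trans (⟦candidate⟧ u h) (cong (λ t → 1# + ⟦ u ⟧ * t) h≡)))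
        (reach-suc ⟦ u ⟧ y reach)) powers) reached)

    Reach-suc : ∀ {n v} → Reach n v → Reach (suc n) v
    Reach-suc reach a a~v = Sum-suc _ (reach a a~v)

    module _ {h : M} (h-power : IsPower h) (exact : HasExactOrder ⟦ h ⟧ (suc e)) where
      hs : List M
      hs = powersFrom h one (suc e)

      level-sound : ∀ n → LevelOK (suc n) (level hs n)
      level-sound zero = record
        { classes = trans ⟦one⟧ (sym (trans (cong class ⟦one⟧) (1^ (suc e)))) ∷ []
        ; reached = subst (Reach 1) (sym (trans (cong class ⟦one⟧) (1^ (suc e)))) reach-one ∷ []
        ; bounded = λ a a∈S₁ → subst (λ u → Inside (u ∷ []) a) (sym ⟦one⟧) (bounded-one a a∈S₁)
        ; one-in  = inj₂ (here (cong class (sym ⟦one⟧)))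
        }
      level-sound (suc n) = record
        { classes = classes
        ; reached = reached
        ; bounded = bounded-suc exact (LevelOK.bounded ih) grow (grow (LevelOK.one-in ih))
            (All.map⁺ (All.tabulate λ {u} u∈us i i<e →
              let v , v∈hs , eq = powersFrom-∈ h one i<e in
              subst (Inside (reps (level hs (suc n))))
                (trans (⟦candidate⟧ (proj₁ u) v) (cong (λ t → 1# + ⟦ proj₁ u ⟧ * t) (⟦hⁱ⟧ {h} i eq)))
                (All.lookup inside (candidates-∈ (∈-map⁺ proj₁ u∈us) v∈hs))))
        ; one-in  = grow (LevelOK.one-in ih)
        }
        where
        ih : LevelOK (suc n) (level hs n)
        ih = level-sound n
        cs : List M
        cs = candidates hs (map proj₁ (level hs n))
        result = insertAll-sound {suc (suc n)} cs (candidates-reach (All.map⁺ (LevelOK.reached ih)) (powersFrom-IsPower h h-power (suc e)))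
                   (LevelOK.classes ih) (All.map Reach-suc (LevelOK.reached ih))
        classes = proj₁ result
        reached = proj₁ (proj₂ result)
        grow = λ {a} → proj₁ (proj₂ (proj₂ result)) {a}
        inside = proj₂ (proj₂ (proj₂ result))

    covers-sound : ∀ {w hs us n} → HasExactOrder ⟦ w ⟧ (suc d) → All IsPower hs →
                   All (λ u → Reach n (class ⟦ u ⟧)) us → T (covers w hs us) → Covers (suc d) (suc n)
    covers-sound {w} {hs} {us} {n} exact powers reached ok = reach-covers exact λ i i<d →
      let v , v∈ , v≡ = powersFrom-∈ w one i<d
          found = anyOf-sound _ (map eth (us ++ candidates hs us)) (All.lookup (allOf-sound _ (powersFrom w one (suc d)) ok) v∈)
      in subst (Reach (suc n)) (trans v≡ (trans (cong (⟦ w ⟧ ^ i *_) ⟦one⟧) (*-identityʳ _)))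
           (All.lookupWith (λ {r} reach r~v →
               subst (Reach (suc n)) (trans (sym (⟦eth⟧ r)) (==-sound (eth r) v r~v)) reach)
             (All.++⁺ (All.map Reach-suc reached) (candidates-reach reached powers))
             (Any.map⁻ found))

    dth-power : ∀ x → IsPower (dth x)
    dth-power x = ⟦ x ⟧ , ⟦dth⟧ x

    dths-IsPower : ∀ xs → All IsPower (map dth xs)
    dths-IsPower xs = All.map⁺ (All.universal dth-power xs)

    twoCheck-sound : ∀ gs {hs} → All IsPower hs → T (twoCheck gs hs) → Verdict 𝔽 d 2
    twoCheck-sound gs {hs} powers ok = (λ _ → All.lookupWith (λ _ → found) (All.universal (λ _ → tt) gs) (anyOf-sound _ gs ok)) , λ { (s≤s (s≤s ())) }
      where
      found : ∀ {g} → T (orderFrom (eth g) (eth g) d ∧ covers (eth g) hs (one ∷ [])) → Covers (suc d) 2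
      found {g} ok = let order , cover = ∧-sound {orderFrom (eth g) (eth g) d} ok in
        covers-sound (exact-order (eth g) d order) powers
          (subst (Reach 1) (sym (trans (cong class ⟦one⟧) (1^ (suc e)))) reach-one ∷ []) cover

    fullCheck-sound : ∀ n gs → T (fullCheck n gs) → Verdict 𝔽 d (2 ℕ.+ n)
    fullCheck-sound n gs ok = All.lookupWith (λ _ → found) (All.universal (λ _ → tt) gs) (anyOf-sound _ gs ok)
      where
      found : ∀ {g} → _ → Verdict 𝔽 d (2 ℕ.+ n)
      found {g} ok =
        let orderω , ok₁ = ∧-sound {orderFrom (eth g) (eth g) d} ok
            orderh , ok₂ = ∧-sound {orderFrom (dth g) (dth g) e} ok₁
            short , cover = ∧-sound ok₂
            exactω = exact-order (eth g) d orderω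
            exacth = exact-order (dth g) e orderh
            us = level (powersFrom (dth g) one (suc e)) n
            levelOK = level-sound (dth-power g) exacth n
        in (λ { j≤6 → [ (λ 4<n → ⊥-elim (ℕ.<⇒≱ (ℕ.<ᵇ⇒< 4 n 4<n) (ℕ.≤-pred (ℕ.≤-pred j≤6))))
                      , covers-sound exactω (powersFrom-IsPower (dth g) (dth-power g) (suc e)) (All.map⁺ (LevelOK.reached levelOK))
                      ]′ (∨-sound cover) })
         , λ _ → bounded-¬covers {⟦ g ⟧} (subst (λ t → HasExactOrder t (suc d)) (⟦eth⟧ g) exactω)
             (subst (_< suc d) (trans (List.length-map proj₁ us) (sym (List.length-map (⟦_⟧ ∘ proj₁) us))) (ℕ.<ᵇ⇒< _ _ short))
             (LevelOK.bounded levelOK)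

  check-sound : ∀ n gs hs → (T bitsOK → All IsPower hs) → T (check n gs hs) → Verdict 𝔽 d (2 ℕ.+ n)
  check-sound zero    gs hs powers ok =
    let bits-ok , two = ∧-sound {bitsOK} ok in twoCheck-sound bits-ok gs (powers bits-ok) two
  check-sound (suc n) gs hs powers ok =
    let bits-ok , full = ∧-sound {bitsOK} ok in fullCheck-sound bits-ok (suc n) gs full

  generatorCheck-sound : ∀ l n g → T (generatorCheck l n g) → Verdict 𝔽 d (2 ℕ.+ n)
  generatorCheck-sound l n g = check-sound n (g ∷ []) (powersFrom (dth g) one l)
    (λ bits-ok → powersFrom-IsPower (dth g) (dth-power bits-ok g) l)

-- The characteristic and the maps from the computed rings

module Characteristic {m} (𝔽 : FiniteField m) where
  open FieldTheory 𝔽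
  open ≡-Reasoning

  -- The n-th power of `p · 1#` is `suc m · 1#`, which is 0, and a field has no nilpotent elements
  -- but 0.
  characteristic : ∀ p n → suc m ≡ p ℕ.^ n → p · 1# ≡ 0#
  characteristic p n q≡ = decidable-stable (p · 1# ≟ 0#) λ p·1≢0 →
    ^-nonZero n p·1≢0 (trans (sym (·1-^ n)) (trans (cong (_· 1#) (sym q≡)) order·1≡0))
    where
    ·1-^ : ∀ n → (p ℕ.^ n) · 1# ≡ (p · 1#) ^ n
    ·1-^ zero    = +-identityʳ 1#
    ·1-^ (suc n) = trans (·1-homo-* p (p ℕ.^ n)) (cong (p · 1# *_) (·1-^ n))

  multiple≡0 : ∀ x {a} → a · 1# ≡ 0# → (x ℕ.* a) · 1# ≡ 0#
  multiple≡0 x {a} a≡0 = trans (·1-homo-* x a) (trans (cong (x · 1# *_) a≡0) (zeroʳ _))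

  bézout-absurd : ∀ u v {a b} → a · 1# ≡ 0# → b · 1# ≡ 0# → 1 ℕ.+ u ℕ.* a ≢ v ℕ.* b
  bézout-absurd u v {a} {b} a≡0 b≡0 eq = 0≢1 (sym (begin
    1#                        ≡⟨ +-identityʳ 1# ⟨
    1# + 0#                   ≡⟨ cong (1# +_) (multiple≡0 u a≡0) ⟨
    (1 ℕ.+ u ℕ.* a) · 1#      ≡⟨ cong (_· 1#) eq ⟩
    (v ℕ.* b) · 1#            ≡⟨ multiple≡0 v b≡0 ⟩
    0#                        ∎))

  module _ {p-1 : ℕ} (p·1≡0 : suc p-1 · 1# ≡ 0#) where
    private
      p : ℕ
      p = suc p-1

    ·1-% : ∀ x → (x % p) · 1# ≡ x · 1#
    ·1-% x = begin
      (x % p) · 1#                            ≡⟨ +-identityʳ _ ⟨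
      (x % p) · 1# + 0#                       ≡⟨ cong ((x % p) · 1# +_) (multiple≡0 (x / p) p·1≡0) ⟨
      (x % p) · 1# + (x / p ℕ.* p) · 1#       ≡⟨ ·-homo-+ 1# (x % p) (x / p ℕ.* p) ⟨
      (x % p ℕ.+ x / p ℕ.* p) · 1#            ≡⟨ cong (_· 1#) (m≡m%n+[m/n]*n x p) ⟨
      x · 1#                                  ∎

    ·1≢0 : Prime p → ∀ x → suc x < p → suc x · 1# ≢ 0#
    ·1≢0 p-prime x x<p x·1≡0 with coprime-Bézout (prime⇒coprime p-prime x<p)
    ... | Bézout.+- u v eq = bézout-absurd v u x·1≡0 p·1≡0 eq
    ... | Bézout.-+ u v eq = bézout-absurd u v p·1≡0 x·1≡0 eq

    ·1≢1 : Prime p → ∀ x → T (not (x ≡ᵇ 1) ∧ (x <ᵇ p)) → x · 1# ≢ 1#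
    ·1≢1 p-prime zero          ok 0≡1   = 0≢1 0≡1
    ·1≢1 p-prime (suc (suc x)) ok x·1≡1 = ·1≢0 p-prime x (ℕ.<-trans (ℕ.n<1+n _) (ℕ.<ᵇ⇒< (suc (suc x)) p ok))
      (+-cancelˡ 1# _ _ (trans x·1≡1 (sym (+-identityʳ 1#))))

    primeArithmetic-represents : Prime p → Represents (primeArithmetic p-1) 𝔽
    primeArithmetic-represents p-prime = record
      { ⟦_⟧          = _· 1#
      ; ⟦zero⟧       = refl
      ; ⟦one⟧        = +-identityʳ 1#
      ; ⟦inc⟧        = λ x → ·1-% (suc x)
      ; ⟦⊗⟧          = λ x y → trans (·1-% (x ℕ.* y)) (·1-homo-* x y)
      ; ==-sound     = λ x y ok → cong (_· 1#) (ℕ.≡ᵇ⇒≡ x y ok)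
      ; apart₁-sound = ·1≢1 p-prime
      }

    module ExtensionSoundness {k} (f : Vec ℕ (suc k)) where
      open Extension p-1 f

      eval : A → ∀ {n} → Vec ℕ n → A
      eval x []               = 0#
      eval x {suc n} (c ∷ cs) = c · 1# * x ^ n + eval x cs

      eval-const+ : ∀ x {n} c (cs : Vec ℕ (suc n)) → eval x (const+ c cs) ≡ c · 1# + eval x cs
      eval-const+ x c (a ∷ []) = begin
        ((c ℕ.+ a) % p) · 1# * 1# + 0#   ≡⟨ cong (λ t → t * 1# + 0#) (trans (·1-% (c ℕ.+ a)) (·-homo-+ 1# c a)) ⟩
        (c · 1# + a · 1#) * 1# + 0#      ≡⟨ trans (+-identityʳ _) (*-identityʳ _) ⟩
        c · 1# + a · 1#                  ≡⟨ cong (c · 1# +_) (trans (+-identityʳ _) (*-identityʳ _)) ⟨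
        c · 1# + (a · 1# * 1# + 0#)      ∎
      eval-const+ x {suc n} c (a ∷ as@(_ ∷ _)) = begin
        a · 1# * x ^ suc n + eval x (const+ c as)     ≡⟨ cong (a · 1# * x ^ suc n +_) (eval-const+ x c as) ⟩
        a · 1# * x ^ suc n + (c · 1# + eval x as)     ≡⟨ solve 3 (λ a c e → a :+ (c :+ e) := c :+ (a :+ e)) refl
                                                           (a · 1# * x ^ suc n) (c · 1#) (eval x as) ⟩
        c · 1# + (a · 1# * x ^ suc n + eval x as)     ∎
        where open 𝔽-Solver

      eval-constant : ∀ x {n} c → eval x (constant {suc n} c) ≡ c · 1#
      eval-constant x {zero}  c = trans (+-identityʳ _) (*-identityʳ _)
      eval-constant x {suc n} c = trans (cong₂ _+_ (zeroˡ _) (eval-constant x {n} c)) (+-identityˡ _)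

      private
        add-terms : ∀ a f u v r x F V R → ((a ℕ.* f ℕ.+ u ℕ.* v ℕ.+ r) % p) · 1# * x + (a · 1# * F + u · 1# * V + R)
                  ≡ a · 1# * (f · 1# * x + F) + u · 1# * (v · 1# * x + V) + (r · 1# * x + R)
        add-terms a f u v r x F V R = trans
          (cong (λ s → s * x + (a · 1# * F + u · 1# * V + R)) (begin
            ((a ℕ.* f ℕ.+ u ℕ.* v ℕ.+ r) % p) · 1#     ≡⟨ ·1-% (a ℕ.* f ℕ.+ u ℕ.* v ℕ.+ r) ⟩
            (a ℕ.* f ℕ.+ u ℕ.* v ℕ.+ r) · 1#           ≡⟨ ·-homo-+ 1# (a ℕ.* f ℕ.+ u ℕ.* v) r ⟩
            (a ℕ.* f ℕ.+ u ℕ.* v) · 1# + r · 1#        ≡⟨ cong (_+ r · 1#) (·-homo-+ 1# (a ℕ.* f) (u ℕ.* v)) ⟩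
            (a ℕ.* f) · 1# + (u ℕ.* v) · 1# + r · 1#   ≡⟨ cong₂ (λ s t → s + t + r · 1#) (·1-homo-* a f) (·1-homo-* u v) ⟩
            a · 1# * f · 1# + u · 1# * v · 1# + r · 1# ∎))
          (solve 9 (λ a f u v r x F V R →
               (a :* f :+ u :* v :+ r) :* x :+ (a :* F :+ u :* V :+ R)
            := a :* (f :* x :+ F) :+ u :* (v :* x :+ V) :+ (r :* x :+ R)) refl
             (a · 1#) (f · 1#) (u · 1#) (v · 1#) (r · 1#) x F V R)
          where open 𝔽-Solver

      eval-combine : ∀ x {n} a (fs : Vec ℕ (suc n)) u (vs : Vec ℕ (suc n)) (rs : Vec ℕ n) →
                     eval x (combine a fs u vs rs) ≡ a · 1# * eval x fs + u · 1# * eval x vs + x * eval x rs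
      eval-combine x a (f ∷ []) u (v ∷ []) [] = begin
        ((a ℕ.* f ℕ.+ u ℕ.* v) % p) · 1# * 1# + 0#
          ≡⟨ cong₂ (λ s t → s * 1# + t) (cong (λ w → (w % p) · 1#) (sym (ℕ.+-identityʳ (a ℕ.* f ℕ.+ u ℕ.* v)))) (sym zeros) ⟩
        ((a ℕ.* f ℕ.+ u ℕ.* v ℕ.+ 0) % p) · 1# * 1# + (a · 1# * 0# + u · 1# * 0# + 0#)
          ≡⟨ add-terms a f u v 0 1# 0# 0# 0# ⟩
        a · 1# * (f · 1# * 1# + 0#) + u · 1# * (v · 1# * 1# + 0#) + (0# * 1# + 0#)
          ≡⟨ cong (a · 1# * (f · 1# * 1# + 0#) + u · 1# * (v · 1# * 1# + 0#) +_)
               (trans (+-identityʳ _) (trans (zeroˡ 1#) (sym (zeroʳ x)))) ⟩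
        a · 1# * (f · 1# * 1# + 0#) + u · 1# * (v · 1# * 1# + 0#) + x * 0# ∎
        where
        zeros : a · 1# * 0# + u · 1# * 0# + 0# ≡ 0#
        zeros = trans (+-identityʳ _) (trans (cong₂ _+_ (zeroʳ _) (zeroʳ _)) (+-identityʳ 0#))
      eval-combine x {suc n} a (f ∷ fs@(_ ∷ _)) u (v ∷ vs@(_ ∷ _)) (r ∷ rs) = begin
        t · 1# * x ^ suc n + eval x (combine a fs u vs rs)
          ≡⟨ cong (t · 1# * x ^ suc n +_) (eval-combine x a fs u vs rs) ⟩
        t · 1# * x ^ suc n + (a · 1# * eval x fs + u · 1# * eval x vs + x * eval x rs)
          ≡⟨ add-terms a f u v r (x ^ suc n) (eval x fs) (eval x vs) (x * eval x rs) ⟩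
        lead + (r · 1# * (x * x ^ n) + x * eval x rs)
          ≡⟨ cong (lead +_) (solve 4 (λ r x y e → r :* (x :* y) :+ x :* e := x :* (r :* y :+ e)) refl
               (r · 1#) x (x ^ n) (eval x rs)) ⟩
        lead + x * (r · 1# * x ^ n + eval x rs) ∎
        where
        open 𝔽-Solver
        t = (a ℕ.* f ℕ.+ u ℕ.* v ℕ.+ r) % p
        lead = a · 1# * (f · 1# * x ^ suc n + eval x fs) + u · 1# * (v · 1# * x ^ suc n + eval x vs)

      eval-shift : ∀ x r (rs : Vec ℕ k) → eval x (shift (r ∷ rs)) ≡ r · 1# * eval x f + x * eval x rs
      eval-shift x r rs = trans (eval-combine x r f 0 f rs)
        (cong (_+ x * eval x rs) (trans (cong (r · 1# * eval x f +_) (zeroˡ _)) (+-identityʳ _)))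

      eqVec-sound : ∀ {n} (vs ws : Vec ℕ n) → T (eqVec vs ws) → vs ≡ ws
      eqVec-sound []       []       _  = refl
      eqVec-sound (v ∷ vs) (w ∷ ws) ok = let v≡w , vs≡ws = ∧-sound {v ≡ᵇ w} ok in
        cong₂ _∷_ (ℕ.≡ᵇ⇒≡ v w v≡w) (eqVec-sound vs ws vs≡ws)

      -- Division of x ^ (s + k + 1) by x ^ (k + 1) − f, with monic quotient h and remainder shifts s f.
      monic-division : ∀ s → ∃ λ h → Monic s h ×
        (∀ x → x ^ (s ℕ.+ suc k) + eval x f * h x ≡ x ^ suc k * h x + eval x (shifts s f))
      monic-division zero = const 1# , (λ _ → refl) , λ x →
        cong₂ _+_ (sym (*-identityʳ _)) (*-identityʳ _)
      monic-division (suc s) with shifts s f | monic-division s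
      ... | r ∷ rs | h , monic , eq = (λ x → x * h x + r · 1#) , (h , r · 1# , monic , λ _ → refl) , λ x → begin
        x * x ^ (s ℕ.+ suc k) + eval x f * (x * h x + r · 1#)
          ≡⟨ solve 5 (λ x y f h r → x :* y :+ f :* (x :* h :+ r) := x :* (y :+ f :* h) :+ r :* f) refl
               x (x ^ (s ℕ.+ suc k)) (eval x f) (h x) (r · 1#) ⟩
        x * (x ^ (s ℕ.+ suc k) + eval x f * h x) + r · 1# * eval x f
          ≡⟨ cong (λ t → x * t + r · 1# * eval x f) (eq x) ⟩
        x * (x * x ^ k * h x + (r · 1# * x ^ k + eval x rs)) + r · 1# * eval x f
          ≡⟨ solve 6 (λ x y h r e f → x :* (x :* y :* h :+ (r :* y :+ e)) :+ r :* f
                                   := x :* y :* (x :* h :+ r) :+ (r :* f :+ x :* e)) refl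
               x (x ^ k) (h x) (r · 1#) (eval x rs) (eval x f) ⟩
        x * x ^ k * (x * h x + r · 1#) + (r · 1# * eval x f + x * eval x rs)
          ≡⟨ cong (x * x ^ k * (x * h x + r · 1#) +_) (eval-shift x r rs) ⟨
        x * x ^ k * (x * h x + r · 1#) + eval x (shift (r ∷ rs)) ∎
        where open 𝔽-Solver

      -- If x ^ (k + 1) − f had no root, the monic quotient of x ^ N − 1 by it would vanish at all
      -- m nonzero (m / N)-th powers.
      root-exists : ∀ s M → suc M ℕ.* (s ℕ.+ suc k) ≡ m → T (rootCheck s) → ∃ λ θ → θ ^ suc k ≡ eval θ f
      root-exists s M MN≡m ok with Fin.any? (λ θ → θ ^ suc k ≟ eval θ f)
      ... | yes root = root
      ... | no none with h , monic , eq ← monic-division s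
        with x , x≢0 , hy≢0 ← nonZero-nonRoot
               (subst (suc M ℕ.* s <_) MN≡m (ℕ.*-monoʳ-< (suc M) (ℕ.m<m+n s (s≤s z≤n)))) (Monic-∘^ M monic)
        = ⊥-elim (none (y , sym (*-cancelʳ hy≢0 (+-cancelˡ 1# _ _ (begin
            1# + eval y f * h y                      ≡⟨ cong (_+ eval y f * h y) y^N≡1 ⟨
            y ^ (s ℕ.+ suc k) + eval y f * h y       ≡⟨ eq y ⟩
            y ^ suc k * h y + eval y (shifts s f)    ≡⟨ cong (y ^ suc k * h y +_) (trans
                                                          (cong (eval y) (eqVec-sound (shifts s f) (constant 1) ok))
                                                          (trans (eval-constant y {k} 1) (+-identityʳ 1#))) ⟩
            y ^ suc k * h y + 1#                     ≡⟨ +-comm _ _ ⟩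
            1# + y ^ suc k * h y                     ∎)))))
        where
        y : A
        y = x ^ suc M
        y^N≡1 : y ^ (s ℕ.+ suc k) ≡ 1#
        y^N≡1 = trans (^-assocʳ x (suc M) (s ℕ.+ suc k)) (trans (cong (x ^_) MN≡m) (fermat x≢0))

      module _ {θ : A} (θ-root : θ ^ suc k ≡ eval θ f) where
        -- The Horner invariant. Here `θ-root` justifies replacing `θ ^ suc k` by `eval θ f`.
        eval-mulAcc : ∀ {n} (us : Vec ℕ n) v acc →
                      eval θ (mulAcc us v acc) ≡ eval θ acc * θ ^ n + eval θ us * eval θ v
        eval-mulAcc [] v acc = sym (trans (cong₂ _+_ (*-identityʳ _) (zeroˡ _)) (+-identityʳ _))
        eval-mulAcc {suc n} (u ∷ us) v (r ∷ rs) = begin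
          eval θ (mulAcc us v (combine r f u v rs))
            ≡⟨ eval-mulAcc us v _ ⟩
          eval θ (combine r f u v rs) * θ ^ n + eval θ us * eval θ v
            ≡⟨ cong (λ t → t * θ ^ n + eval θ us * eval θ v) (trans (eval-combine θ r f u v rs)
                 (cong (λ t → r · 1# * t + u · 1# * eval θ v + θ * eval θ rs) (sym θ-root))) ⟩
          (r · 1# * (θ * θ ^ k) + u · 1# * eval θ v + θ * eval θ rs) * θ ^ n + eval θ us * eval θ v
            ≡⟨ solve 8 (λ r x y u v e z w → (r :* (x :* y) :+ u :* v :+ x :* e) :* z :+ w :* v
                                         := (r :* y :+ e) :* (x :* z) :+ (u :* z :+ w) :* v) refl
                 (r · 1#) θ (θ ^ k) (u · 1#) (eval θ v) (eval θ rs) (θ ^ n) (eval θ us) ⟩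
          (r · 1# * θ ^ k + eval θ rs) * (θ * θ ^ n) + (u · 1# * θ ^ n + eval θ us) * eval θ v ∎
          where open 𝔽-Solver

        eval-mul : ∀ u v → eval θ (mul u v) ≡ eval θ u * eval θ v
        eval-mul u v = trans (eval-mulAcc u v (constant 0))
          (trans (cong (_+ eval θ u * eval θ v) (trans (cong (_* θ ^ suc k) (eval-constant θ {k} 0)) (zeroˡ _))) (+-identityˡ _))

        ring-represents : ∀ apart → (∀ x → T (apart x) → eval θ x ≢ 1#) → Represents (ringArithmetic apart) 𝔽
        ring-represents apart apart-sound = record
          { ⟦_⟧          = eval θ
          ; ⟦zero⟧       = eval-constant θ {k} 0
          ; ⟦one⟧        = trans (eval-constant θ {k} 1) (+-identityʳ 1#)
          ; ⟦inc⟧        = λ x → trans (eval-const+ θ 1 x) (cong (_+ eval θ x) (+-identityʳ 1#))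
          ; ⟦⊗⟧          = eval-mul
          ; ==-sound     = λ x y ok → cong (eval θ) (eqVec-sound x y ok)
          ; apart₁-sound = apart-sound
          }

        unit-sound : ∀ {m-1} → suc m-1 ≡ m → ∀ x → T (isUnit (suc m-1) x) → eval θ x ≢ 0#
        unit-sound {m-1} m≡ x ok = let bits-ok , unit = ∧-sound {fromBits (bits 20 (suc m-1)) ≡ᵇ suc m-1} ok in
          root-nonZero m-1 (trans (sym (⟦power-bits⟧ (bits 20 (suc m-1)) (suc m-1) bits-ok x))
            (trans (cong (eval θ) (eqVec-sound (Arithmetic.power (ringArithmetic (λ _ → false)) x (bits 20 (suc m-1))) (constant 1) unit)) (trans (eval-constant θ {k} 1) (+-identityʳ 1#))))
          where open ArithmeticSoundness (ring-represents (const false) (λ _ ()))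

        extension-represents : ∀ {m-1} → suc m-1 ≡ m → Represents (extensionArithmetic (suc m-1)) 𝔽
        extension-represents m≡ = ring-represents _ λ x ok x≡1 → unit-sound m≡ (const+ p-1 x) ok (begin
          eval θ (const+ p-1 x)   ≡⟨ eval-const+ θ p-1 x ⟩
          p-1 · 1# + eval θ x     ≡⟨ cong (p-1 · 1# +_) x≡1 ⟩
          p-1 · 1# + 1#           ≡⟨ +-comm _ _ ⟩
          suc p-1 · 1#            ≡⟨ p·1≡0 ⟩
          0#                      ∎)

-- Transport of an abstract field to `Fin`

module Transport {c ℓ₁ ℓ₂} (F : HeytingField c ℓ₁ ℓ₂) {m} (order : HasOrder F (suc m)) where
  private
    R : CommutativeRing c ℓ₁
    R = HeytingCommutativeRing.commutativeRing (HeytingField.heytingCommutativeRing F)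
    module F = HeytingField F
    module R = CommutativeRing R
  open Inverse order using (to; from; to-cong; from-cong; strictlyInverseˡ; strictlyInverseʳ)
  open Algebra.Properties.Semiring.Exp R.semiring using () renaming (_^_ to _^ᶠ_)

  private
    from-injective : ∀ {x y} → from x R.≈ from y → x ≡ y
    from-injective {x} {y} eq =
      trans (sym (strictlyInverseˡ x)) (trans (to-cong eq) (strictlyInverseˡ y))

    to-injective : ∀ {a b} → to a ≡ to b → a R.≈ b
    to-injective {a} {b} eq =
      R.trans (R.sym (strictlyInverseʳ a)) (R.trans (from-cong eq) (strictlyInverseʳ b))

    rawRing : RawRing _ _
    rawRing = record
      { Carrier = Fin (suc m)
      ; _≈_ = _≡_
      ; _+_ = λ x y → to (from x R.+ from y)
      ; _*_ = λ x y → to (from x R.* from y)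
      ; -_  = λ x → to (R.- from x)
      ; 0#  = to R.0#
      ; 1#  = to R.1#
      }

    -- The ring laws on `Fin (suc m)` are pulled back along the injective `from`.
    from-isMonomorphism : IsRingMonomorphism rawRing (CommutativeRing.rawRing R) from
    from-isMonomorphism = record
      { isRingHomomorphism = record
        { isSemiringHomomorphism = record
          { isNearSemiringHomomorphism = record
            { +-isMonoidHomomorphism = record
              { isMagmaHomomorphism = record
                { isRelHomomorphism = record { cong = from-cong }
                ; homo = λ x y → strictlyInverseʳ _
                }
              ; ε-homo = strictlyInverseʳ _
              }
            ; *-homo = λ x y → strictlyInverseʳ _
            }
          ; 1#-homo = strictlyInverseʳ _
          }
        ; -‿homo = λ x → strictlyInverseʳ _
        }
      ; injective = from-injective
      }

    -- Apartness in a Heyting field means that the difference is invertible. As `1 − 0` is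
    -- invertible, tightness forbids equality.
    0≉1 : ¬ R.0# R.≈ R.1#
    0≉1 0≈1 = proj₂ (F.tight R.1# R.0#) (R.sym 0≈1)
      (F.invertible⇒# (R.1# , R.trans (R.*-identityˡ _) 1-0≈1 , R.trans (R.*-identityʳ _) 1-0≈1))
      where
      open Algebra.Properties.Ring R.ring using (-0#≈0#)
      1-0≈1 : R.1# R.- R.0# R.≈ R.1#
      1-0≈1 = R.trans (R.+-congˡ -0#≈0#) (R.+-identityʳ _)

    -- Apartness only gives a doubly negated inverse, but on a finite carrier one can be searched for.
    inverse′ : ∀ x → x ≢ to R.0# → ∃ λ y → to (from x R.* from y) ≡ to R.1#
    inverse′ x x≢0 with Fin.any? (λ y → to (from x R.* from y) Fin.≟ to R.1#)
    ... | yes found = found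
    ... | no none   = ⊥-elim (x≢0 (trans (sym (strictlyInverseˡ x)) (to-cong
      (proj₁ (F.tight (from x) R.0#) λ x#0 →
        let y , _ , xy≈1 = F.#⇒invertible x#0 in
        none (to y , to-cong (R.trans (R.*-cong (R.sym x-0≈x) (strictlyInverseʳ y)) xy≈1))))))
      where
      open Algebra.Properties.Ring R.ring using (-0#≈0#)
      x-0≈x : from x R.- R.0# R.≈ from x
      x-0≈x = R.trans (R.+-congˡ -0#≈0#) (R.+-identityʳ _)

  𝔽 : FiniteField m
  𝔽 = record
    { isCommutativeRing = RingMonomorphism.isCommutativeRing from-isMonomorphism R.isCommutativeRing
    ; 0≢1               = 0≉1 ∘ to-injective
    ; inverse           = inverse′
    }

  open FieldTheory 𝔽 using (A; _+_; _^_)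
  open PowerSums 𝔽

  private
    to-+ : ∀ a b → to (a R.+ b) ≡ to a + to b
    to-+ a b = to-cong (R.sym (R.+-cong (strictlyInverseʳ a) (strictlyInverseʳ b)))

    to-^ : ∀ a k → to (a ^ᶠ k) ≡ to a ^ k
    to-^ a zero    = refl
    to-^ a (suc k) = to-cong (R.*-cong (R.sym (strictlyInverseʳ a))
      (R.trans (R.sym (strictlyInverseʳ _)) (from-cong (to-^ a k))))

  IsSumOfPowers⇒Sum : ∀ k n {a} → IsSumOfPowers F k n a → Sum k n (to a)
  IsSumOfPowers⇒Sum k zero    (x , sum≈a) = to-cong (R.sym sum≈a)
  IsSumOfPowers⇒Sum k (suc n) (x , sum≈a) =
    to (x zero) , _ , IsSumOfPowers⇒Sum k n (Vector.tail x , R.refl) ,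
    trans (to-cong (R.sym sum≈a)) (trans (to-+ _ _) (cong (_+ _) (to-^ (x zero) k)))

  Sum⇒IsSumOfPowers : ∀ k n {a} → Sum k n (to a) → IsSumOfPowers F k n a
  Sum⇒IsSumOfPowers k zero    a≡0 = (λ ()) , R.sym (to-injective a≡0)
  Sum⇒IsSumOfPowers k (suc n) {a} (x , b , b∈Sₙ , a≡)
    with y , sum≈b ← Sum⇒IsSumOfPowers k n {from b} (subst (Sum k n) (sym (strictlyInverseˡ b)) b∈Sₙ) =
    from x Vector.∷ y , R.trans (R.+-congˡ sum≈b) (to-injective (trans (to-+ _ _)
      (trans (cong₂ _+_ (trans (to-^ (from x) k) (cong (_^ k) (strictlyInverseˡ x))) (strictlyInverseˡ b)) (sym a≡))))

  covers⇒Covers : ∀ k n → (∀ a → IsSumOfPowers F k n a) → Covers k n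
  covers⇒Covers k n covers a =
    subst (Sum k n) (strictlyInverseˡ a) (IsSumOfPowers⇒Sum k n (covers (from a)))

  Covers⇒covers : ∀ k n → Covers k n → ∀ a → IsSumOfPowers F k n a
  Covers⇒covers k n covers a = Sum⇒IsSumOfPowers k n (covers (to a))

-- Reduction of the exponent k to gcd (k, q - 1)

module ReduceExponent {m} (𝔽 : FiniteField m) where
  open FieldTheory 𝔽
  open PowerSums 𝔽

  Sum-map : ∀ {k l} → (∀ x → ∃ λ y → x ^ k ≡ y ^ l) → ∀ n {a} → Sum k n a → Sum l n a
  Sum-map powers zero    a≡0               = a≡0
  Sum-map powers (suc n) (x , b , b∈S , a≡) with y , x^k≡ ← powers x =
    y , b , Sum-map powers n b∈S , trans a≡ (cong (_+ b) x^k≡)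

  multiple-power : ∀ {d k} → d ∣ k → ∀ x → ∃ λ y → x ^ k ≡ y ^ d
  multiple-power {d} (divides c refl) x = x ^ c , sym (^-assocʳ x c d)

  -- Bézout writes `suc d` as a combination of `suc k` and `m`, and `x ^ m` is 1 for nonzero `x`.
  gcd-power : ∀ {d k} → Bézout.Identity (suc d) (suc k) m → ∀ x → ∃ λ y → x ^ suc d ≡ y ^ suc k
  gcd-power {d} {k} identity x with x ≟ 0#
  ... | yes x≡0 = 0# , trans (power-≡0 d x≡0) (sym (0^ k))
  ... | no x≢0 = power identity
    where
    open ≡-Reasoning
    x^[vm]≡1 : ∀ v → x ^ (v ℕ.* m) ≡ 1#
    x^[vm]≡1 v = begin
      x ^ (v ℕ.* m)   ≡⟨ ^-assocʳ x v m ⟨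
      (x ^ v) ^ m     ≡⟨ ^-comm x v m ⟩
      (x ^ m) ^ v     ≡⟨ cong (_^ v) (fermat x≢0) ⟩
      1# ^ v          ≡⟨ 1^ v ⟩
      1#              ∎
    power : Bézout.Identity (suc d) (suc k) m → ∃ λ y → x ^ suc d ≡ y ^ suc k
    power (Bézout.+- u v eq) = x ^ u , (begin
      x ^ suc d                       ≡⟨ *-identityʳ _ ⟨
      x ^ suc d * 1#                  ≡⟨ cong (x ^ suc d *_) (x^[vm]≡1 v) ⟨
      x ^ suc d * x ^ (v ℕ.* m)       ≡⟨ ^-homo-* x (suc d) (v ℕ.* m) ⟨
      x ^ (suc d ℕ.+ v ℕ.* m)         ≡⟨ cong (x ^_) eq ⟩
      x ^ (u ℕ.* suc k)               ≡⟨ ^-assocʳ x u (suc k) ⟨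
      (x ^ u) ^ suc k                 ∎)
    -- Here `suc k` has the coefficient `− u`, so the inverse of `x` takes the place of `x`.
    power (Bézout.-+ u v eq) = let i , xi≡1 = inverse x x≢0 in i ^ u , (begin
      x ^ suc d                                        ≡⟨ *-identityʳ _ ⟨
      x ^ suc d * 1#                                   ≡⟨ cong (x ^ suc d *_) (trans (cong (_^ (u ℕ.* suc k)) xi≡1) (1^ (u ℕ.* suc k))) ⟨
      x ^ suc d * (x * i) ^ (u ℕ.* suc k)              ≡⟨ cong (x ^ suc d *_) (^-distrib-* x i (u ℕ.* suc k)) ⟩
      x ^ suc d * (x ^ (u ℕ.* suc k) * i ^ (u ℕ.* suc k))   ≡⟨ *-assoc _ _ _ ⟨
      x ^ suc d * x ^ (u ℕ.* suc k) * i ^ (u ℕ.* suc k)   ≡⟨ cong (_* i ^ (u ℕ.* suc k)) (^-homo-* x (suc d) (u ℕ.* suc k)) ⟨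
      x ^ (suc d ℕ.+ u ℕ.* suc k) * i ^ (u ℕ.* suc k)  ≡⟨ cong (λ t → x ^ t * i ^ (u ℕ.* suc k)) eq ⟩
      x ^ (v ℕ.* m) * i ^ (u ℕ.* suc k)                ≡⟨ cong (_* i ^ (u ℕ.* suc k)) (x^[vm]≡1 v) ⟩
      1# * i ^ (u ℕ.* suc k)                           ≡⟨ *-identityˡ _ ⟩
      i ^ (u ℕ.* suc k)                                ≡⟨ ^-assocʳ i u (suc k) ⟨
      (i ^ u) ^ suc k                                  ∎)

  Covers-gcd : ∀ {d k} → gcd (suc k) m ≡ suc d → ∀ n →
               (Covers (suc k) n → Covers (suc d) n) × (Covers (suc d) n → Covers (suc k) n)
  Covers-gcd {d} {k} gcd≡ n =
    (λ covers a → Sum-map (multiple-power (subst (_∣ suc k) gcd≡ (gcd[m,n]∣m (suc k) m))) n (covers a)) ,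
    (λ covers a → Sum-map (gcd-power (subst (λ t → Bézout.Identity t (suc k) m) gcd≡
                             (Bézout.identity (gcd-GCD (suc k) m)))) n (covers a))

-- Tables

member : ℕ → List ℕ → Bool
member q = anyOf (q ≡ᵇ_)

member-sound : ∀ {q} qs → T (member q qs) → q ∈ qs
member-sound {q} qs ok = Any.map (ℕ.≡ᵇ⇒≡ q _) (anyOf-sound (q ≡ᵇ_) qs ok)

-- Only the orders q with k ∣ q − 1 matter in `verdictList k j`. The list for j = 7 collects those for
-- which γ(k, q) > 6 or γ(k, q) does not exist.
verdictList : ℕ → ℕ → List ℕ
verdictList 3  3 = 7 ∷ []
verdictList 3  7 = 4 ∷ []
verdictList 4  7 = 9 ∷ []
verdictList 5  7 = 16 ∷ []
verdictList 6  7 = 25 ∷ []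
verdictList 7  7 = 8 ∷ []
verdictList 8  7 = 9 ∷ 17 ∷ 49 ∷ []
verdictList 9  7 = 19 ∷ 64 ∷ []
verdictList 10 7 = 11 ∷ 81 ∷ []
verdictList 11 7 = 23 ∷ []
verdictList 12 7 = 13 ∷ 25 ∷ 121 ∷ []
verdictList 13 7 = 27 ∷ []
verdictList 14 7 = 29 ∷ 169 ∷ []
verdictList 15 7 = 16 ∷ 31 ∷ []
verdictList 16 7 = 17 ∷ 49 ∷ []
verdictList 17 7 = 256 ∷ []
verdictList 18 7 = 19 ∷ 37 ∷ 73 ∷ 289 ∷ []
verdictList k  j = waringList k j

excessAmong : List ℕ → ℕ → ℕ → ℕ
excessAmong []       k q = 0
excessAmong (x ∷ xs) k q = if member q (verdictList k (2 ℕ.+ x)) then x else excessAmong xs k q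

-- Abstract, so that comparing the types of the soundness lemmas does not unfold the tables.
abstract
  -- The verdict minus 2, which is 0 for an unlisted q.
  excess : ℕ → ℕ → ℕ
  excess = excessAmong (1 ∷ 2 ∷ 3 ∷ 4 ∷ 5 ∷ [])

  excess-sound : ∀ k q → excess k q ≡ 0 ⊎
                 (excess k q ∈ 1 ∷ 2 ∷ 3 ∷ 4 ∷ 5 ∷ [] × q ∈ verdictList k (2 ℕ.+ excess k q))
  excess-sound k q = among (1 ∷ 2 ∷ 3 ∷ 4 ∷ 5 ∷ [])
    where
    among : ∀ xs → excessAmong xs k q ≡ 0 ⊎
            (excessAmong xs k q ∈ xs × q ∈ verdictList k (2 ℕ.+ excessAmong xs k q))
    among []       = inj₁ refl
    among (x ∷ xs) with member q (verdictList k (2 ℕ.+ x)) in eq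
    ... | true  = inj₂ (here refl , member-sound _ (subst T (sym eq) tt))
    ... | false = [ inj₁ , (λ (x∈ , q∈) → inj₂ (there x∈ , q∈)) ]′ (among xs)

-- The primes below `19 ² = 361`, enough to factor every composite number up to `19 ⁴ + 1`.
-- Soundness rests only on the factors found; a composite that slipped through would merely have to
-- pass `primeCheck`.
smallPrimes : List ℕ
smallPrimes =
  2 ∷ 3 ∷ 5 ∷ 7 ∷ 11 ∷ 13 ∷ 17 ∷ 19 ∷ 23 ∷ 29 ∷ 31 ∷ 37 ∷ 41 ∷ 43 ∷ 47 ∷ 53 ∷ 59 ∷ 61 ∷ 67 ∷
  71 ∷ 73 ∷ 79 ∷ 83 ∷ 89 ∷ 97 ∷ 101 ∷ 103 ∷ 107 ∷ 109 ∷ 113 ∷ 127 ∷ 131 ∷ 137 ∷ 139 ∷ 149 ∷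
  151 ∷ 157 ∷ 163 ∷ 167 ∷ 173 ∷ 179 ∷ 181 ∷ 191 ∷ 193 ∷ 197 ∷ 199 ∷ 211 ∷ 223 ∷ 227 ∷ 229 ∷
  233 ∷ 239 ∷ 241 ∷ 251 ∷ 257 ∷ 263 ∷ 269 ∷ 271 ∷ 277 ∷ 281 ∷ 283 ∷ 293 ∷ 307 ∷ 311 ∷ 313 ∷
  317 ∷ 331 ∷ 337 ∷ 347 ∷ 349 ∷ 353 ∷ 359 ∷ []

-- The bound `r ² ≤ q` with `r ≥ 2` makes the divisor proper.
dividesᵇ : ℕ → ℕ → Bool
dividesᵇ (suc (suc r)) q = (suc (suc r) ℕ.* suc (suc r) ≤ᵇ q) ∧ (0 ≡ᵇ q % suc (suc r))
dividesᵇ _             q = false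

abstract
  hasFactor : ℕ → Bool
  hasFactor q = anyOf (λ r → dividesᵇ r q) smallPrimes

  hasFactor-sound : ∀ q → T (hasFactor q) → ¬ Prime q
  hasFactor-sound q ok q-prime =
    let r , r∣q = Any.satisfied (anyOf-sound (λ r → dividesᵇ r q) smallPrimes ok) in factor r r∣q q-prime
    where
    factor : ∀ r → T (dividesᵇ r q) → ¬ Prime q
    factor (suc (suc r)) ok (prime notComposite) =
      let r²≤q , q%r≡0 = ∧-sound {suc (suc r) ℕ.* suc (suc r) ≤ᵇ q} ok in
      notComposite (composite {d = suc (suc r)}
        (ℕ.<-≤-trans (ℕ.m<m*n (suc (suc r)) (suc (suc r)) (s≤s (s≤s z≤n))) (ℕ.≤ᵇ⇒≤ _ q r²≤q))
        (m%n≡0⇒n∣m q (suc (suc r)) (sym (ℕ.≡ᵇ⇒≡ 0 (q % suc (suc r)) q%r≡0))))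

data Entry : Set where
  entry : ∀ (p-1 k : ℕ) (f g : Vec ℕ (suc k)) (s : ℕ) → Entry

-- `entry (p − 1) (n − 1) f g s` presents the field of order p ^ n as 𝔽ₚ[x]/(x ^ n − f): the class of x
-- is a root of unity of order n + s, and that of g generates the multiplicative group.
-- All p ^ n ≤ 19⁴ + 1 with n ≥ 2 are listed for which some k ≤ 19 divides p ^ n − 1 ≤ k⁴.
extensions : List Entry
extensions =
  entry 1 1 (1 ∷ 1 ∷ []) (1 ∷ 0 ∷ []) 1 ∷
  entry 1 2 (0 ∷ 1 ∷ 1 ∷ []) (0 ∷ 1 ∷ 0 ∷ []) 4 ∷
  entry 2 1 (0 ∷ 2 ∷ []) (1 ∷ 1 ∷ []) 2 ∷
  entry 1 3 (1 ∷ 1 ∷ 1 ∷ 1 ∷ []) (0 ∷ 0 ∷ 1 ∷ 1 ∷ []) 1 ∷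
  entry 4 1 (4 ∷ 4 ∷ []) (1 ∷ 2 ∷ []) 1 ∷
  entry 2 2 (0 ∷ 1 ∷ 1 ∷ []) (0 ∷ 2 ∷ 0 ∷ []) 10 ∷
  entry 6 1 (0 ∷ 6 ∷ []) (1 ∷ 2 ∷ []) 2 ∷
  entry 1 5 (0 ∷ 0 ∷ 1 ∷ 0 ∷ 0 ∷ 1 ∷ []) (0 ∷ 0 ∷ 0 ∷ 0 ∷ 1 ∷ 1 ∷ []) 3 ∷
  entry 2 3 (2 ∷ 2 ∷ 2 ∷ 2 ∷ []) (0 ∷ 0 ∷ 1 ∷ 2 ∷ []) 1 ∷
  entry 10 1 (10 ∷ 10 ∷ []) (1 ∷ 4 ∷ []) 1 ∷
  entry 4 2 (1 ∷ 0 ∷ 1 ∷ []) (0 ∷ 1 ∷ 1 ∷ []) 28 ∷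
  entry 12 1 (7 ∷ 12 ∷ []) (1 ∷ 2 ∷ []) 5 ∷
  entry 2 4 (0 ∷ 1 ∷ 2 ∷ 1 ∷ 1 ∷ []) (0 ∷ 0 ∷ 0 ∷ 1 ∷ 1 ∷ []) 6 ∷
  entry 1 7 (0 ∷ 0 ∷ 1 ∷ 1 ∷ 1 ∷ 0 ∷ 0 ∷ 1 ∷ []) (0 ∷ 0 ∷ 0 ∷ 0 ∷ 0 ∷ 0 ∷ 1 ∷ 1 ∷ []) 9 ∷
  entry 16 1 (16 ∷ 16 ∷ []) (1 ∷ 3 ∷ []) 1 ∷
  entry 6 2 (0 ∷ 0 ∷ 2 ∷ []) (0 ∷ 1 ∷ 1 ∷ []) 6 ∷
  entry 18 1 (0 ∷ 18 ∷ []) (1 ∷ 3 ∷ []) 2 ∷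
  entry 1 8 (1 ∷ 0 ∷ 0 ∷ 0 ∷ 0 ∷ 0 ∷ 0 ∷ 0 ∷ 1 ∷ []) (0 ∷ 0 ∷ 0 ∷ 0 ∷ 0 ∷ 0 ∷ 1 ∷ 1 ∷ 1 ∷ []) 64 ∷
  entry 22 1 (22 ∷ 22 ∷ []) (1 ∷ 5 ∷ []) 1 ∷
  entry 4 3 (2 ∷ 0 ∷ 2 ∷ 4 ∷ []) (0 ∷ 0 ∷ 1 ∷ 2 ∷ []) 9 ∷
  entry 2 5 (2 ∷ 2 ∷ 2 ∷ 2 ∷ 2 ∷ 2 ∷ []) (0 ∷ 0 ∷ 0 ∷ 1 ∷ 1 ∷ 2 ∷ []) 1 ∷
  entry 28 1 (28 ∷ 28 ∷ []) (1 ∷ 6 ∷ []) 1 ∷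
  entry 30 1 (0 ∷ 30 ∷ []) (1 ∷ 4 ∷ []) 2 ∷
  entry 1 9 (1 ∷ 1 ∷ 1 ∷ 1 ∷ 1 ∷ 1 ∷ 1 ∷ 1 ∷ 1 ∷ 1 ∷ []) (0 ∷ 0 ∷ 0 ∷ 0 ∷ 0 ∷ 0 ∷ 1 ∷ 0 ∷ 1 ∷ 1 ∷ []) 1 ∷
  entry 10 2 (4 ∷ 5 ∷ 1 ∷ []) (0 ∷ 1 ∷ 9 ∷ []) 4 ∷
  entry 36 1 (0 ∷ 6 ∷ []) (1 ∷ 1 ∷ []) 6 ∷
  entry 40 1 (40 ∷ 40 ∷ []) (1 ∷ 3 ∷ []) 1 ∷
  entry 42 1 (0 ∷ 42 ∷ []) (1 ∷ 2 ∷ []) 2 ∷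
  entry 12 2 (0 ∷ 0 ∷ 3 ∷ []) (0 ∷ 1 ∷ 2 ∷ []) 6 ∷
  entry 46 1 (46 ∷ 46 ∷ []) (1 ∷ 4 ∷ []) 1 ∷
  entry 6 3 (6 ∷ 6 ∷ 6 ∷ 6 ∷ []) (0 ∷ 0 ∷ 1 ∷ 3 ∷ []) 1 ∷
  entry 52 1 (52 ∷ 52 ∷ []) (1 ∷ 5 ∷ []) 1 ∷
  entry 4 4 (1 ∷ 1 ∷ 4 ∷ 2 ∷ 1 ∷ []) (0 ∷ 0 ∷ 0 ∷ 1 ∷ 2 ∷ []) 6 ∷
  entry 58 1 (58 ∷ 58 ∷ []) (1 ∷ 4 ∷ []) 1 ∷
  entry 60 1 (0 ∷ 11 ∷ []) (1 ∷ 1 ∷ []) 6 ∷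
  entry 1 11 (1 ∷ 1 ∷ 1 ∷ 1 ∷ 1 ∷ 1 ∷ 1 ∷ 1 ∷ 1 ∷ 1 ∷ 1 ∷ 1 ∷ []) (0 ∷ 0 ∷ 0 ∷ 0 ∷ 0 ∷ 0 ∷ 0 ∷ 0 ∷ 1 ∷ 0 ∷ 1 ∷ 1 ∷ []) 1 ∷
  entry 66 1 (0 ∷ 66 ∷ []) (1 ∷ 7 ∷ []) 2 ∷
  entry 16 2 (3 ∷ 0 ∷ 1 ∷ []) (0 ∷ 1 ∷ 1 ∷ []) 304 ∷
  entry 70 1 (70 ∷ 70 ∷ []) (1 ∷ 4 ∷ []) 1 ∷
  entry 72 1 (0 ∷ 10 ∷ []) (1 ∷ 5 ∷ []) 14 ∷
  entry 78 1 (0 ∷ 78 ∷ []) (1 ∷ 6 ∷ []) 2 ∷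
  entry 2 7 (0 ∷ 0 ∷ 0 ∷ 1 ∷ 0 ∷ 0 ∷ 0 ∷ 1 ∷ []) (0 ∷ 0 ∷ 0 ∷ 0 ∷ 0 ∷ 0 ∷ 1 ∷ 1 ∷ []) 24 ∷
  entry 18 2 (0 ∷ 0 ∷ 4 ∷ []) (0 ∷ 1 ∷ 5 ∷ []) 24 ∷
  entry 82 1 (82 ∷ 82 ∷ []) (1 ∷ 4 ∷ []) 1 ∷
  entry 88 1 (88 ∷ 88 ∷ []) (1 ∷ 3 ∷ []) 1 ∷
  entry 96 1 (25 ∷ 96 ∷ []) (1 ∷ 6 ∷ []) 5 ∷
  entry 100 1 (100 ∷ 100 ∷ []) (1 ∷ 19 ∷ []) 1 ∷
  entry 102 1 (0 ∷ 102 ∷ []) (1 ∷ 2 ∷ []) 2 ∷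
  entry 106 1 (106 ∷ 106 ∷ []) (1 ∷ 3 ∷ []) 1 ∷
  entry 108 1 (10 ∷ 108 ∷ []) (1 ∷ 3 ∷ []) 3 ∷
  entry 22 2 (9 ∷ 10 ∷ 1 ∷ []) (0 ∷ 1 ∷ 3 ∷ []) 4 ∷
  entry 112 1 (112 ∷ 112 ∷ []) (1 ∷ 7 ∷ []) 1 ∷
  entry 10 3 (0 ∷ 3 ∷ 0 ∷ 1 ∷ []) (0 ∷ 0 ∷ 1 ∷ 1 ∷ []) 12 ∷
  entry 4 5 (4 ∷ 4 ∷ 4 ∷ 4 ∷ 4 ∷ 4 ∷ []) (0 ∷ 0 ∷ 0 ∷ 0 ∷ 1 ∷ 2 ∷ []) 1 ∷
  entry 126 1 (0 ∷ 126 ∷ []) (1 ∷ 8 ∷ []) 2 ∷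
  entry 130 1 (130 ∷ 130 ∷ []) (1 ∷ 12 ∷ []) 1 ∷
  entry 136 1 (136 ∷ 136 ∷ []) (1 ∷ 5 ∷ []) 1 ∷
  entry 138 1 (0 ∷ 138 ∷ []) (1 ∷ 4 ∷ []) 2 ∷
  entry 2 8 (1 ∷ 0 ∷ 0 ∷ 0 ∷ 0 ∷ 1 ∷ 0 ∷ 0 ∷ 1 ∷ []) (0 ∷ 0 ∷ 0 ∷ 0 ∷ 0 ∷ 0 ∷ 0 ∷ 1 ∷ 1 ∷ []) 748 ∷
  entry 148 1 (148 ∷ 148 ∷ []) (1 ∷ 4 ∷ []) 1 ∷
  entry 150 1 (0 ∷ 150 ∷ []) (1 ∷ 9 ∷ []) 2 ∷
  entry 28 2 (12 ∷ 3 ∷ 1 ∷ []) (0 ∷ 1 ∷ 1 ∷ []) 10 ∷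
  entry 156 1 (0 ∷ 28 ∷ []) (1 ∷ 2 ∷ []) 6 ∷
  entry 162 1 (0 ∷ 162 ∷ []) (1 ∷ 7 ∷ []) 2 ∷
  entry 166 1 (166 ∷ 166 ∷ []) (1 ∷ 7 ∷ []) 1 ∷
  entry 12 3 (12 ∷ 12 ∷ 12 ∷ 12 ∷ []) (0 ∷ 0 ∷ 1 ∷ 2 ∷ []) 1 ∷
  entry 30 2 (0 ∷ 0 ∷ 5 ∷ []) (0 ∷ 1 ∷ 2 ∷ []) 6 ∷
  entry 178 1 (178 ∷ 178 ∷ []) (1 ∷ 3 ∷ []) 1 ∷
  entry 180 1 (37 ∷ 180 ∷ []) (1 ∷ 6 ∷ []) 5 ∷
  entry 190 1 (190 ∷ 190 ∷ []) (1 ∷ 5 ∷ []) 1 ∷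
  entry 192 1 (7 ∷ 192 ∷ []) (1 ∷ 2 ∷ []) 95 ∷
  entry 196 1 (196 ∷ 196 ∷ []) (1 ∷ 4 ∷ []) 1 ∷
  entry 198 1 (0 ∷ 198 ∷ []) (1 ∷ 13 ∷ []) 2 ∷
  entry 210 1 (0 ∷ 210 ∷ []) (1 ∷ 4 ∷ []) 2 ∷
  entry 222 1 (0 ∷ 222 ∷ []) (1 ∷ 2 ∷ []) 2 ∷
  entry 36 2 (8 ∷ 9 ∷ 1 ∷ []) (0 ∷ 1 ∷ 5 ∷ []) 4 ∷
  entry 226 1 (226 ∷ 226 ∷ []) (1 ∷ 13 ∷ []) 1 ∷
  entry 228 1 (81 ∷ 228 ∷ []) (1 ∷ 3 ∷ []) 3 ∷
  entry 232 1 (232 ∷ 232 ∷ []) (1 ∷ 5 ∷ []) 1 ∷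
  entry 238 1 (238 ∷ 238 ∷ []) (1 ∷ 4 ∷ []) 1 ∷
  entry 240 1 (28 ∷ 240 ∷ []) (1 ∷ 4 ∷ []) 9 ∷
  entry 250 1 (250 ∷ 250 ∷ []) (1 ∷ 7 ∷ []) 1 ∷
  entry 1 15 (1 ∷ 0 ∷ 0 ∷ 0 ∷ 0 ∷ 0 ∷ 0 ∷ 1 ∷ 0 ∷ 0 ∷ 0 ∷ 0 ∷ 0 ∷ 0 ∷ 1 ∷ 1 ∷ []) (0 ∷ 0 ∷ 0 ∷ 0 ∷ 0 ∷ 0 ∷ 0 ∷ 0 ∷ 0 ∷ 0 ∷ 0 ∷ 0 ∷ 0 ∷ 1 ∷ 1 ∷ 1 ∷ []) 241 ∷
  entry 268 1 (268 ∷ 268 ∷ []) (1 ∷ 3 ∷ []) 1 ∷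
  entry 270 1 (0 ∷ 270 ∷ []) (1 ∷ 5 ∷ []) 2 ∷
  entry 42 2 (0 ∷ 0 ∷ 6 ∷ []) (0 ∷ 1 ∷ 3 ∷ []) 6 ∷
  entry 16 3 (16 ∷ 16 ∷ 16 ∷ 16 ∷ []) (0 ∷ 0 ∷ 1 ∷ 2 ∷ []) 1 ∷
  entry 306 1 (0 ∷ 306 ∷ []) (1 ∷ 9 ∷ []) 2 ∷
  entry 6 5 (0 ∷ 0 ∷ 0 ∷ 0 ∷ 0 ∷ 3 ∷ []) (0 ∷ 0 ∷ 0 ∷ 0 ∷ 1 ∷ 1 ∷ []) 30 ∷ []

-- Tests over all small orders and over the tables

entryCheck : (p′ k′ d e m : ℕ) → Entry → Bool
entryCheck p′ k′ d e m (entry p-1 k f g s) =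
  (suc p′ ≡ᵇ p-1) ∧ (suc k′ ≡ᵇ k) ∧ (0 ≡ᵇ m % suc (s ℕ.+ k)) ∧ Extension.rootCheck p-1 f s ∧
  Check.generatorCheck (Extension.extensionArithmetic p-1 f m) d e 600 (excess (suc d) (suc m)) g

allBelow : ℕ → (ℕ → Bool) → Bool
allBelow zero    f = true
allBelow (suc n) f = f n ∧ allBelow n f

allBelow-sound : ∀ n (f : ℕ → Bool) → T (allBelow n f) → ∀ {i} → i < n → T (f i)
allBelow-sound (suc n) f ok i<1+n = let fn , rest = ∧-sound {f n} ok in
  [ allBelow-sound n f rest , (λ { refl → fn }) ]′ (ℕ.m≤n⇒m<n∨m≡n (ℕ.≤-pred i<1+n))

cube : ℕ → ℕ
cube k = k ℕ.* (k ℕ.* k)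

primeTest : ℕ → ℕ → Bool
primeTest d e = hasFactor (suc m) ∨ primeCheck d e (excess (suc d) (suc m))
  where
  m : ℕ
  m = suc d ℕ.* suc e

-- Since `m` is `suc d ℕ.* suc e`, the condition `m ≤ (suc d) ⁴` amounts to `e < cube (suc d)`.
primesTest : ℕ → Bool
primesTest d = allBelow (cube (suc d)) (primeTest d)

disjunction-sound : ∀ {A : Set} a b (p : A → Bool) xs → T a → ¬ T b →
                    T (not a ∨ b ∨ anyOf p xs) → ∃ λ x → T (p x)
disjunction-sound true false p xs _ _  ok = Any.satisfied (anyOf-sound p xs ok)
disjunction-sound true true  p xs _ ¬b ok = ⊥-elim (¬b tt)

abstract
  -- The exponent `suc d` needs a certificate only if it divides `m` with a quotient of at most
  -- `(suc d) ³`. The field in question has order `(p′ + 2) ^ (k′ + 2)`.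
  extensionTestIndex : (p′ k′ m d : ℕ) → Bool
  extensionTestIndex p′ k′ m d =
    not (m % suc d ≡ᵇ 0) ∨ (cube (suc d) <ᵇ m / suc d) ∨
    anyOf (entryCheck p′ k′ d (pred (m / suc d)) m) extensions

  extensionTestIndex-∃ : ∀ p′ k′ m d → T (m % suc d ≡ᵇ 0) → ¬ T (cube (suc d) <ᵇ m / suc d) →
                         T (extensionTestIndex p′ k′ m d) →
                         ∃ λ x → T (entryCheck p′ k′ d (pred (m / suc d)) m x)
  extensionTestIndex-∃ p′ k′ m d = disjunction-sound (m % suc d ≡ᵇ 0) (cube (suc d) <ᵇ m / suc d)
    (entryCheck p′ k′ d (pred (m / suc d)) m) extensions

extensionTestIndex-sound : ∀ p′ k′ {m d e} → m ≡ suc e ℕ.* suc d → e < cube (suc d) →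
                           T (extensionTestIndex p′ k′ m d) → ∃ λ x → T (entryCheck p′ k′ d e m x)
extensionTestIndex-sound p′ k′ {m} {d} {e} m≡ e<k³ ok =
  let x , x-ok = extensionTestIndex-∃ p′ k′ m d (ℕ.≡⇒≡ᵇ (m % suc d) 0 m%k≡0)
                   (λ large → ℕ.<⇒≱ (ℕ.<-≤-trans (ℕ.<ᵇ⇒< (cube (suc d)) (m / suc d) large)
                                                 (ℕ.≤-reflexive m/k≡)) e<k³) ok
  in x , subst (λ t → T (entryCheck p′ k′ d t m x)) (cong pred m/k≡) x-ok
  where
  m/k≡ : m / suc d ≡ suc e
  m/k≡ = trans (cong (_/ suc d) m≡) (m*n/n≡m (suc e) (suc d))
  m%k≡0 : m % suc d ≡ 0
  m%k≡0 = trans (cong (_% suc d) m≡) (m*n%n≡0 (suc e) (suc d))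

-- `130322 = 19 ⁴ + 1` is the largest order not settled by the incidence bound for some exponent up
-- to 19.
extensionTestAt : ℕ → ℕ → ℕ → Bool
extensionTestAt p′ k′ q =
  (130322 <ᵇ q) ∨ hasFactor (suc (suc p′)) ∨ allBelow 19 (extensionTestIndex p′ k′ (pred q))

extensionTest : ℕ → ℕ → Bool
extensionTest p′ k′ = extensionTestAt p′ k′ (suc (suc p′) ℕ.^ suc (suc k′))

fourth : ℕ → ℕ
fourth k = k ℕ.* k ℕ.* (k ℕ.* k)

extensionsTest : ℕ → Bool
extensionsTest p′ = allBelow 15 (extensionTest p′)

-- Guarantees that no order settled by the incidence bound is tabulated, so that its verdict is 2.
smallTest : ℕ → ℕ → Bool
smallTest d x = allOf (λ q → pred q ≤ᵇ fourth (suc d)) (verdictList (suc d) (2 ℕ.+ x))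

smallTests : ℕ → Bool
smallTests d = allOf (smallTest d) (1 ∷ 2 ∷ 3 ∷ 4 ∷ 5 ∷ [])

verdictTest : ℕ → ℕ → ℕ → Bool
verdictTest k j q = (2 ℕ.+ excess (gcd k (pred q)) q) ≡ᵇ j

verdictTests : ℕ → ℕ → Bool
verdictTests k j = allOf (verdictTest k j) (waringList k j)

-- The converse of `verdictTest`: an order tabulated for `d` must be listed for each `k` that has
-- `d` as its gcd with `q − 1`.
waringTest : ℕ → ℕ → ℕ → ℕ → Bool
waringTest k d j q = not (gcd k (pred q) ≡ᵇ d) ∨ member q (waringList k j)

waringTests : ℕ → ℕ → ℕ → Bool
waringTests k d j = allOf (waringTest k d j) (verdictList d j)

≡true⇒T : ∀ {b} → b ≡ true → T b
≡true⇒T refl = tt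

abstract
  primes-verified : allBelow 19 primesTest ≡ true
  primes-verified = refl

  extensions-verified : allBelow 360 extensionsTest ≡ true
  extensions-verified = refl

  verdicts-small : allBelow 19 smallTests ≡ true
  verdicts-small = refl

  waringList⊆verdictList : allBelow 20 (λ k → allBelow 7 (verdictTests k)) ≡ true
  waringList⊆verdictList = refl

  verdictList⊆waringList : allBelow 16 (λ k → allBelow 20 (λ d → allBelow 7 (waringTests (4 ℕ.+ k) d))) ≡ true
  verdictList⊆waringList = refl

-- Verdicts for all fields

excess-large : ∀ {d m} → d < 19 → fourth (suc d) < m → excess (suc d) (suc m) ≡ 0
excess-large {d} {m} d<19 large with excess-sound (suc d) (suc m)
... | inj₁ none      = none
... | inj₂ (x∈ , q∈) = ⊥-elim (ℕ.<⇒≱ large (ℕ.≤ᵇ⇒≤ m (fourth (suc d))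
  (All.lookup (allOf-sound (λ q → pred q ≤ᵇ fourth (suc d)) (verdictList (suc d) (2 ℕ.+ excess (suc d) (suc m)))
    (All.lookup (allOf-sound (smallTest d) (1 ∷ 2 ∷ 3 ∷ 4 ∷ 5 ∷ [])
      (allBelow-sound 19 smallTests (≡true⇒T verdicts-small) d<19)) x∈)) q∈)))

primeCheck-sound : ∀ {m} (𝔽 : FiniteField m) → Prime (suc m) → ∀ {d e} → suc d ℕ.* suc e ≡ m →
                   ∀ x → T (primeCheck d e x) → Verdict 𝔽 d (2 ℕ.+ x)
primeCheck-sound 𝔽 q-prime {d} {e} refl x =
  check-sound x (range 1 100) (map (Check.dth (primeArithmetic (suc d ℕ.* suc e)) d e) (range 1 600)) 
    (λ bits-ok → dths-IsPower bits-ok (range 1 600))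
  where
  open FieldTheory 𝔽 using (order·1≡0)
  open Characteristic 𝔽
  open CheckSoundness (primeArithmetic-represents order·1≡0 q-prime) {d} {e} refl

prime-verdict : ∀ {m} (𝔽 : FiniteField m) → Prime (suc m) → ∀ {d e} → d < 19 → e < cube (suc d) →
                suc d ℕ.* suc e ≡ m → Verdict 𝔽 d (2 ℕ.+ excess (suc d) (suc m))
prime-verdict {m} 𝔽 q-prime {d} {e} d<19 e<k³ de≡m =
  [ (λ factor → ⊥-elim (hasFactor-sound (suc m) factor q-prime))
  , primeCheck-sound 𝔽 q-prime de≡m (excess (suc d) (suc m))
  ]′ (∨-sound {hasFactor (suc m)} {primeCheck d e (excess (suc d) (suc m))} passed)
  where
  passed : T (hasFactor (suc m) ∨ primeCheck d e (excess (suc d) (suc m)))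
  passed = subst (λ m → T (hasFactor (suc m) ∨ primeCheck d e (excess (suc d) (suc m)))) de≡m
    (allBelow-sound (cube (suc d)) (primeTest d) (allBelow-sound 19 primesTest (≡true⇒T primes-verified) d<19) e<k³)

module _ {m-1} (𝔽 : FiniteField (suc m-1)) {p′ k′} (p-prime : Prime (suc (suc p′)))
         (q≡ : suc (suc m-1) ≡ suc (suc p′) ℕ.^ suc (suc k′)) where
  private
    m : ℕ
    m = suc m-1

  extensionCheck-sound : ∀ {d e} → suc d ℕ.* suc e ≡ m → ∀ p-1 {k} (f g : Vec ℕ (suc k)) s l x M →
                         p-1 ≡ suc p′ → k ≡ suc k′ → m ≡ M ℕ.* suc (s ℕ.+ k) →
                         T (Extension.rootCheck p-1 f s) → T (Check.generatorCheck (Extension.extensionArithmetic p-1 f m) d e l x g) →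
                         Verdict 𝔽 d (2 ℕ.+ x)
  extensionCheck-sound {d} {e} de≡m _ f g s l x (suc M) refl refl m≡MN root ok =
    CheckSoundness.generatorCheck-sound
      (ExtensionSoundness.extension-represents {suc p′} p·1≡0 f (proj₂ rooted) refl) {d} {e} de≡m l x g ok
    where
    open Characteristic 𝔽
    p·1≡0 = characteristic (suc (suc p′)) (suc (suc k′)) q≡
    rooted = ExtensionSoundness.root-exists {suc p′} p·1≡0 f s M
               (trans (cong (suc M ℕ.*_) (ℕ.+-suc s (suc k′))) (sym m≡MN)) root

  entry-verdict : ∀ {d e} → suc d ℕ.* suc e ≡ m → ∀ x → T (entryCheck p′ k′ d e m x) →
                  Verdict 𝔽 d (2 ℕ.+ excess (suc d) (suc m))
  entry-verdict {d} {e} de≡m (entry p-1 k f g s) ok =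
    let p≡ , ok₁ = ∧-sound {suc p′ ≡ᵇ p-1} ok
        k≡ , ok₂ = ∧-sound {suc k′ ≡ᵇ k} ok₁
        N∣m , ok₃ = ∧-sound {0 ≡ᵇ m % suc (s ℕ.+ k)} ok₂
        root , ok₄ = ∧-sound {Extension.rootCheck p-1 f s} ok₃
        divides M m≡MN = m%n≡0⇒n∣m m (suc (s ℕ.+ k)) (sym (ℕ.≡ᵇ⇒≡ 0 (m % suc (s ℕ.+ k)) N∣m))
    in extensionCheck-sound {d} {e} de≡m p-1 f g s 600 (excess (suc d) (suc m)) M
         (sym (ℕ.≡ᵇ⇒≡ (suc p′) p-1 p≡)) (sym (ℕ.≡ᵇ⇒≡ (suc k′) k k≡)) m≡MN root ok₄

  extension-verdict : ∀ {d e} → p′ < 360 → k′ < 15 → suc m ≤ 130322 → d < 19 → e < cube (suc d) →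
                      suc d ℕ.* suc e ≡ m → Verdict 𝔽 d (2 ℕ.+ excess (suc d) (suc m))
  extension-verdict {d} {e} p′< k′< q≤ d<19 e<k³ de≡m =
    [ (λ large → ⊥-elim (ℕ.<⇒≱ (ℕ.<ᵇ⇒< 130322 (suc m) large) q≤))
    , [ (λ factor → ⊥-elim (hasFactor-sound (suc (suc p′)) factor p-prime))
      , (λ tests → let x , ok = extensionTestIndex-sound p′ k′ (trans (sym de≡m) (ℕ.*-comm (suc d) (suc e))) e<k³
                                  (allBelow-sound 19 (extensionTestIndex p′ k′ m) tests d<19)
                   in entry-verdict de≡m x ok)
      ]′ ∘ ∨-sound {hasFactor (suc (suc p′))} {allBelow 19 (extensionTestIndex p′ k′ m)}
    ]′ (∨-sound {130322 <ᵇ suc m} {hasFactor (suc (suc p′)) ∨ allBelow 19 (extensionTestIndex p′ k′ m)}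
         (subst (T ∘ extensionTestAt p′ k′) (sym q≡)
           (allBelow-sound 15 (extensionTest p′) (allBelow-sound 360 extensionsTest (≡true⇒T extensions-verified) p′<) k′<)))

verdict : ∀ {m} (𝔽 : FiniteField m) {p n} → Prime p → 1 ≤ n → suc m ≡ p ℕ.^ n →
          ∀ {d e} → d < 19 → suc d ℕ.* suc e ≡ m → Verdict 𝔽 d (2 ℕ.+ excess (suc d) (suc m))
verdict {m} 𝔽 {p} {n} p-prime 1≤n q≡ {d} {e} d<19 de≡m with ℕ.<-≤-connex (fourth (suc d)) m
... | inj₁ large = subst (λ x → Verdict 𝔽 d (2 ℕ.+ x)) (sym (excess-large d<19 large))
  ((λ _ → PowerSums.large-covers 𝔽 d large) , λ { (s≤s (s≤s ())) })
... | inj₂ small = by-degree p n p-prime 1≤n q≡ m de≡m refl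
  where
  e<k³ : e < cube (suc d)
  e<k³ = ℕ.*-cancelˡ-≤ (suc d) (ℕ.≤-trans (ℕ.≤-reflexive de≡m)
    (ℕ.≤-trans small (ℕ.≤-reflexive (ℕ.*-assoc (suc d) (suc d) (suc d ℕ.* suc d)))))
  q≤ : suc m ≤ 130322
  q≤ = s≤s (ℕ.≤-trans small (ℕ.*-mono-≤ (ℕ.*-mono-≤ d<19 d<19) (ℕ.*-mono-≤ d<19 d<19)))
  by-degree : ∀ p n → Prime p → 1 ≤ n → suc m ≡ p ℕ.^ n → ∀ m′ → suc d ℕ.* suc e ≡ m′ → m ≡ m′ →
              Verdict 𝔽 d (2 ℕ.+ excess (suc d) (suc m))
  by-degree p 1 p-prime _ q≡ _ _ _ =
    prime-verdict 𝔽 (subst Prime (sym (trans q≡ (ℕ.*-identityʳ p))) p-prime) d<19 e<k³ de≡m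
  by-degree (suc (suc p′)) (suc (suc k′)) p-prime _ q≡ (suc m-1) de≡m refl =
    extension-verdict 𝔽 p-prime q≡ (ℕ.≰⇒> p′≱) (ℕ.≰⇒> k′≱) q≤ d<19 e<k³ de≡m
    where
    pⁿ = suc (suc p′) ℕ.^ suc (suc k′)
    q≤′ : pⁿ ≤ 130322
    q≤′ = subst (_≤ 130322) q≡ q≤
    -- The bounds on p and n hold because `362 ² = 131044` and `2 ¹⁷ = 131072` both exceed
    -- `19 ⁴ + 1`.
    p′≱ : ¬ 360 ≤ p′
    p′≱ 360≤p′ = ℕ.<⇒≱ (ℕ.<ᵇ⇒< 130322 131044 tt) (ℕ.≤-trans
      (ℕ.≤-trans (ℕ.^-monoˡ-≤ 2 (ℕ.+-monoʳ-≤ 2 360≤p′)) (ℕ.^-monoʳ-≤ (suc (suc p′)) {2} {suc (suc k′)} (s≤s (s≤s z≤n)))) q≤′)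
    k′≱ : ¬ 15 ≤ k′
    k′≱ 15≤k′ = ℕ.<⇒≱ (ℕ.<ᵇ⇒< 130322 131072 tt) (ℕ.≤-trans
      (ℕ.≤-trans (ℕ.^-monoʳ-≤ 2 (ℕ.+-monoʳ-≤ 2 15≤k′)) (ℕ.^-monoˡ-≤ (suc (suc k′)) {2} {suc (suc p′)} (s≤s (s≤s z≤n)))) q≤′)

-- From verdicts to Waring numbers

module WaringNumber {c ℓ₁ ℓ₂} (F : HeytingField c ℓ₁ ℓ₂) {m} (order : HasOrder F (suc m))
                    {k d v} (gcd≡ : gcd (suc k) m ≡ suc d)
                    (0<v : 0 < v) (verdict : Verdict (Transport.𝔽 F order) d v) where
  open Transport F order
  open PowerSums 𝔽
  open ReduceExponent 𝔽

  private
    reached : v ≤ 6 → ∀ a → IsSumOfPowers F (suc k) v a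
    reached v≤6 = Covers⇒covers (suc k) v (proj₂ (Covers-gcd {d} gcd≡ v) (proj₁ verdict v≤6))

    minimal : 3 ≤ v → ∀ n → (∀ a → IsSumOfPowers F (suc k) n a) → v ≤ n
    -- As 0 is a power, covering with some `n < v` would give covering with `pred v` powers.
    minimal 3≤v n covers = ℕ.≮⇒≥ λ n<v → proj₂ verdict 3≤v λ a →
      Sum-≤ {d} (ℕ.≤⇒≤′ (ℕ.<⇒≤pred n<v)) (proj₁ (Covers-gcd {d} gcd≡ n) (covers⇒Covers (suc k) n covers) a)

  -- The verdicts 2 and 7 do not determine γ but exclude such a `j`: 2 contradicts its minimality, 7
  -- its covering.
  unique : ∀ {j} → 3 ≤ j → j ≤ 6 → IsWaringNumber F (suc k) j → v ≡ j
  unique {j} 3≤j j≤6 isWaring with ℕ.<-cmp v j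
  ... | tri≈ _ v≡j _ = v≡j
  ... | tri> _ _ j<v = ⊥-elim (ℕ.<⇒≱ j<v
    (minimal (ℕ.≤-trans 3≤j (ℕ.<⇒≤ j<v)) j (IsWaringNumber.covers isWaring)))
  ... | tri< v<j _ _ = ⊥-elim (ℕ.<⇒≱ v<j (IsWaringNumber.minimal isWaring v 0<v
    (reached (ℕ.≤-trans (ℕ.<⇒≤ v<j) j≤6))))

  isWaringNumber : 3 ≤ v → v ≤ 6 → IsWaringNumber F (suc k) v
  isWaringNumber 3≤v v≤6 = record
    { positive = ℕ.≤-trans (s≤s z≤n) 3≤v
    ; covers   = reached v≤6
    ; minimal  = λ n _ → minimal 3≤v n
    }

¬FiniteField-0 : ¬ FiniteField 0
¬FiniteField-0 𝔽 = FiniteField.0≢1 𝔽 (all-equal _ _)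
  where
  all-equal : (x y : Fin 1) → x ≡ y
  all-equal zero zero = refl

waringList⇒verdict : ∀ {k j q} → k ≤ 19 → j ≤ 6 → q ∈ waringList k j → 2 ℕ.+ excess (gcd k (pred q)) q ≡ j
waringList⇒verdict {k} {j} {q} k≤19 j≤6 q∈ = ℕ.≡ᵇ⇒≡ _ j (All.lookup
  (allOf-sound (verdictTest k j) (waringList k j)
    (allBelow-sound 7 (verdictTests k)
      (allBelow-sound 20 (λ k → allBelow 7 (verdictTests k)) (≡true⇒T waringList⊆verdictList) (s≤s k≤19)) (s≤s j≤6))) q∈)

-- A verdict of at least 3 comes from a table entry at `d = gcd k m`, where `d` may be below 4: 7 is
-- listed for `k = 9` because of `d = 3`. Comparing the tables for all `k` and `d` moves the entry
-- to `k`.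
verdict⇒waringList : ∀ {k m j} → 4 ≤ k → k ≤ 19 → 3 ≤ j → j ≤ 6 →
                     2 ℕ.+ excess (gcd k m) (suc m) ≡ j → suc m ∈ waringList k j
verdict⇒waringList {k@(suc (suc (suc (suc k-4))))} {m} {j} (s≤s (s≤s (s≤s (s≤s _)))) k≤19 3≤j j≤6 v≡j
  with excess-sound (gcd k m) (suc m)
... | inj₁ x≡0 = ⊥-elim (ℕ.<⇒≱ 3≤j (ℕ.≤-reflexive (trans (sym v≡j) (cong (2 ℕ.+_) x≡0))))
... | inj₂ (_ , q∈) = member-sound (waringList k j) (implication gcd-test (All.lookup
  (allOf-sound (waringTest k (gcd k m) j) (verdictList (gcd k m) j)
    (allBelow-sound 7 (waringTests k (gcd k m))
      (allBelow-sound 20 (λ d → allBelow 7 (waringTests k d))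
        (allBelow-sound 16 (λ k → allBelow 20 (λ d → allBelow 7 (waringTests (4 ℕ.+ k) d)))
          (≡true⇒T verdictList⊆waringList) (ℕ.+-cancelˡ-≤ 4 _ _ (ℕ.≤-trans (ℕ.≤-reflexive (ℕ.+-suc 4 k-4)) (s≤s k≤19))))
        (s≤s (ℕ.≤-trans (∣⇒≤ (gcd[m,n]∣m k m)) k≤19)))
      (s≤s j≤6)))
  (subst (λ v → suc m ∈ verdictList (gcd k m) v) v≡j q∈)))
  where
  implication : ∀ {a b} → T a → T (not a ∨ b) → T b
  implication {true} _ b = b
  gcd-test : T (gcd k m ≡ᵇ gcd k m)
  gcd-test = ℕ.≡⇒≡ᵇ (gcd k m) (gcd k m) refl

theorem3p6 : ∀ {c ℓ₁ ℓ₂} (k : ℕ) → 4 ≤ k → k ≤ 19 →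
    (q : ℕ) → IsPrimePower q →
    (F : HeytingField c ℓ₁ ℓ₂) → HasOrder F q →
    (j : ℕ) → j ∈ (3 ∷ 4 ∷ 5 ∷ 6 ∷ []) →
    IsWaringNumber F k j ⇔ q ∈ waringList k j
theorem3p6 (suc k) 4≤k k≤19 q (p , n , p-prime , 1≤n , q≡) F order j j∈ = by-order q q≡ order
  where
  3≤j : 3 ≤ j
  3≤j = All.lookup {P = 3 ≤_} (ℕ.≤ᵇ⇒≤ 3 3 tt ∷ ℕ.≤ᵇ⇒≤ 3 4 tt ∷ ℕ.≤ᵇ⇒≤ 3 5 tt ∷ ℕ.≤ᵇ⇒≤ 3 6 tt ∷ []) j∈
  j≤6 : j ≤ 6
  j≤6 = All.lookup {P = _≤ 6} (ℕ.≤ᵇ⇒≤ 3 6 tt ∷ ℕ.≤ᵇ⇒≤ 4 6 tt ∷ ℕ.≤ᵇ⇒≤ 5 6 tt ∷ ℕ.≤ᵇ⇒≤ 6 6 tt ∷ []) j∈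

  by-gcd : ∀ {m} → suc m ≡ p ℕ.^ n → (order : HasOrder F (suc m)) → ∀ d → gcd (suc k) m ≡ d → d ∣ m →
           IsWaringNumber F (suc k) j ⇔ suc m ∈ waringList (suc k) j
  by-gcd {m} q≡ order zero gcd≡ _ = ⊥-elim (gcd[m,n]≢0 (suc k) m (inj₁ λ ()) gcd≡)
  -- Here `m` is 0, which would be a field with a single element.
  by-gcd q≡ order (suc d) gcd≡ (divides zero refl) = ⊥-elim (¬FiniteField-0 (Transport.𝔽 F order))
  by-gcd {m} q≡ order (suc d) gcd≡ (divides (suc e) m≡) = mk⇔
    (λ isWaring → verdict⇒waringList 4≤k k≤19 3≤j j≤6
      (trans (cong (λ d → 2 ℕ.+ excess d (suc m)) gcd≡) (W.unique 3≤j j≤6 isWaring)))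
    (λ q∈ → let v≡j = trans (cong (λ d → 2 ℕ.+ excess d (suc m)) (sym gcd≡)) (waringList⇒verdict k≤19 j≤6 q∈) in
      subst (IsWaringNumber F (suc k)) v≡j
        (W.isWaringNumber (subst (3 ≤_) (sym v≡j) 3≤j) (subst (_≤ 6) (sym v≡j) j≤6)))
    where
    d<19 : d < 19
    d<19 = ℕ.≤-trans (∣⇒≤ (subst (_∣ suc k) gcd≡ (gcd[m,n]∣m (suc k) m))) k≤19
    module W = WaringNumber F order {k} {d} {2 ℕ.+ excess (suc d) (suc m)} gcd≡ (s≤s z≤n)
      (verdict (Transport.𝔽 F order) p-prime 1≤n q≡ {d} {e} d<19 (trans (ℕ.*-comm (suc d) (suc e)) (sym m≡)))

  by-order : ∀ q → q ≡ p ℕ.^ n → HasOrder F q → IsWaringNumber F (suc k) j ⇔ q ∈ waringList (suc k) j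
  by-order zero    q≡ order = ⊥-elim (Fin.¬Fin0 (Inverse.to order (HeytingField.0# F)))
  by-order (suc m) q≡ order = by-gcd q≡ order (gcd (suc k) m) refl (gcd[m,n]∣n (suc k) m)
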